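{- For every integer $r\geq 1$, the $r$-dimensional hypercube $Q_r$ satisfies $$\mathrm{gpn}(Q_r)=2^{r-1}\cdot r!\sum_{j=0}^{r-1}\frac{1}{j!}+2^{r},$$ and consequently $\mathrm{gpn}(Q_r)\sim 2^{r-1}\cdot r!\cdot e+2^{r}$ as $r\to\infty$ (i.e. the ratio of the two sides tends to $1$).
   Context: For distinct vertices $u,v$ of a connected simple graph $G$, $\mathrm{gpn}_G(u,v)$ denotes the number of shortest $u$–$v$ paths in $G$, and for a graph $G$ on $n$ vertices $\mathrm{gpn}(G)=\sum_{\{u,v\}\subseteq V(G),\,u\neq v}\mathrm{gpn}_G(u,v)+n$ (sum over unordered pairs of distinct vertices). $Q_r$ is the graph with vertex set $\{0,1\}^r$ in which two vertices are adjacent if and only if they differ in exactly one coordinate; it has $2^r$ vertices. Here $e$ is the base of the natural logarithm. -}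

module Defs where

open import Data.Bool.Base using (Bool; true; false)
import Data.Bool.Properties as Bool
open import Data.Empty using (⊥-elim)
import Data.Fin.Properties as Fin
open import Data.Integer.Base as ℤ using (+_; +[1+_])
import Data.Integer.Properties as ℤ
open import Data.List.Base using (List; []; _∷_; _++_; map; filter; concatMap; length; head; last; upTo; cartesianProductWith)
open import Data.List.Membership.Propositional using (_∈_)
open import Data.List.Membership.Propositional.Properties using (∈-cartesianProductWith⁺)
import Data.List.Relation.Unary.All as All
open import Data.List.Relation.Unary.AllPairs using ([]; _∷_)
open import Data.List.Relation.Unary.Any using (here; there)
open import Data.List.Relation.Unary.Linked using (Linked; linked?)
open import Data.List.Relation.Unary.Unique.Propositional using (Unique)
import Data.List.Relation.Unary.Unique.Propositional.Properties as Unique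
import Data.List.Relation.Unary.Unique.DecPropositional as DecUnique
open import Data.Maybe.Base using (just)
import Data.Maybe.Properties as Maybe
open import Data.Nat.Base as ℕ using (ℕ; zero; suc; _!)
import Data.Nat.Properties as ℕ
open import Data.Nat.Properties using (_!≢0)
open import Data.Nat.ListAction using (sum)
open import Data.Product using (Σ-syntax; ∃; ∃!; ∃-syntax; _×_; _,_; proj₁; proj₂; uncurry)
open import Data.Rational.Base as ℚ using (ℚ; mkℚ; 0ℚ; 1ℚ; ½)
import Data.Rational.Properties as ℚ
open import Data.Rational.Solver using (module +-*-Solver)
import Data.Rational.Unnormalised.Base as ℚᵘ
import Data.Rational.Unnormalised.Properties as ℚᵘ
open import Data.Sum.Base using (inj₁; inj₂)
open import Data.Vec.Base using (Vec; []; _∷_; lookup)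
import Data.Vec.Properties as Vec
open import Function.Base using (_∘_)
open import Relation.Binary.Core using (Rel)
open import Relation.Binary.Definitions using (Decidable; DecidableEquality; Symmetric; Irreflexive)
open import Relation.Binary.PropositionalEquality using (_≡_; _≢_; refl; sym; trans; cong; cong₂; subst; subst₂)
open import Relation.Nullary.Decidable.Core using (Dec; yes; no; ¬?; _×-dec_; _→-dec_; map′)
import Relation.Unary as U

record FiniteSimpleGraph : Set₁ where
  field
    Vertex   : Set
    _≟_      : DecidableEquality Vertex
    vertices : List Vertex
    complete : ∀ v → v ∈ vertices
    unique   : Unique vertices
    Adj      : Rel Vertex _
    adj?     : Decidable Adj
    adj-sym  : Symmetric Adj
    adj-irr  : Irreflexive _≡_ Adj

-- Each two-element subset of a duplicate-free list is listed exactly once.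
unorderedPairs : ∀ {A : Set} → List A → List (A × A)
unorderedPairs []       = []
unorderedPairs (x ∷ xs) = map (x ,_) xs ++ unorderedPairs xs

words : ∀ {A : Set} → List A → ℕ → List (List A)
words xs zero    = [] ∷ []
words xs (suc k) = cartesianProductWith _∷_ xs (words xs k)

module _ (G : FiniteSimpleGraph) where
  open FiniteSimpleGraph G

  order : ℕ
  order = length vertices

  IsPath : Vertex → Vertex → List Vertex → Set
  IsPath u v p = head p ≡ just u × last p ≡ just v × Linked Adj p × Unique p

  isPath? : ∀ u v → U.Decidable (IsPath u v)
  isPath? u v p = Maybe.≡-dec _≟_ (head p) (just u)
            ×-dec Maybe.≡-dec _≟_ (last p) (just v)
            ×-dec linked? adj? p
            ×-dec DecUnique.unique? _≟_ p

  -- A path repeats no vertex, so it has at most `order` vertices and the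
  -- list is exhaustive.
  paths : Vertex → Vertex → List (List Vertex)
  paths u v = filter (isPath? u v) (concatMap (words vertices) (upTo (suc order)))

  shortestPaths : Vertex → Vertex → List (List Vertex)
  shortestPaths u v =
    filter (λ p → All.all? (λ q → length p ℕ.≤? length q) (paths u v)) (paths u v)

  gpn⟨_,_⟩ : Vertex → Vertex → ℕ
  gpn⟨ u , v ⟩ = length (shortestPaths u v)

  -- Intended for connected graphs; a pair in different components
  -- contributes 0.
  gpn : ℕ
  gpn = sum (map (uncurry gpn⟨_,_⟩) (unorderedPairs vertices)) ℕ.+ order

DifferInOne : ∀ {r} → Rel (Vec Bool r) _
DifferInOne u v = ∃! _≡_ λ i → lookup u i ≢ lookup v i

differInOne? : ∀ {r} → Decidable (DifferInOne {r})
differInOne? u v = Fin.any? λ i → differ? i ×-dec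
  map′ (λ f {j} → f j) (λ f j → f {j}) (Fin.all? λ j → differ? j →-dec i Fin.≟ j)
  where
  differ? : ∀ i → Dec (lookup u i ≢ lookup v i)
  differ? i = ¬? (lookup u i Bool.≟ lookup v i)

allBits : ∀ r → List (Vec Bool r)
allBits zero    = [] ∷ []
allBits (suc r) = cartesianProductWith _∷_ (false ∷ true ∷ []) (allBits r)

allBits-complete : ∀ {r} (v : Vec Bool r) → v ∈ allBits r
allBits-complete []      = here refl
allBits-complete (b ∷ v) = ∈-cartesianProductWith⁺ _∷_ (bit b) (allBits-complete v)
  where
  bit : ∀ b → b ∈ (false ∷ true ∷ [])
  bit false = here refl
  bit true  = there (here refl)

allBits-unique : ∀ r → Unique (allBits r)
allBits-unique zero    = All.[] ∷ []
allBits-unique (suc r) =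
  Unique.cartesianProductWith⁺ _∷_ Vec.∷-injective
    (((λ ()) All.∷ All.[]) ∷ All.[] ∷ []) (allBits-unique r)

Q : ℕ → FiniteSimpleGraph
Q r = record
  { Vertex   = Vec Bool r
  ; _≟_      = Vec.≡-dec Bool._≟_
  ; vertices = allBits r
  ; complete = allBits-complete
  ; unique   = allBits-unique r
  ; Adj      = DifferInOne
  ; adj?     = differInOne?
  ; adj-sym  = λ { (i , i≢ , !i) → i , i≢ ∘ sym , λ j≢ → !i (j≢ ∘ sym) }
  ; adj-irr  = λ { refl (_ , i≢ , _) → i≢ refl }
  }

fromℕ : ℕ → ℚ
fromℕ n = + n ℚ./ 1

∑< : ℕ → (ℕ → ℚ) → ℚ
∑< zero    f = 0ℚ
∑< (suc n) f = ∑< n f ℚ.+ f n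

syntax ∑< n (λ j → t) = ∑[ j < n ] t

1/_! : ℕ → ℚ
1/ j ! = (+ 1 ℚ./ (j !)) {{j !≢0}}

module ℚ-Lemmas where
  open import Data.Rational.Base using (_+_; _*_; _-_; -_; ∣_∣; _≤_; _<_; nonNegative; positive)
  open +-*-Solver using (solve; _:=_; _:+_; _:*_; _:-_; :-_; con)
  open ℚ.≤-Reasoning

  ∣-∣-≤ : ∀ {p c} → p ≤ c → - p ≤ c → ∣ p ∣ ≤ c
  ∣-∣-≤ {p} p≤c -p≤c with ℚ.∣p∣≡p∨∣p∣≡-p p
  ... | inj₁ eq = subst (_≤ _) (sym eq) p≤c
  ... | inj₂ eq = subst (_≤ _) (sym eq) -p≤c

  ∣p-q∣≡∣q-p∣ : ∀ p q → ∣ p - q ∣ ≡ ∣ q - p ∣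
  ∣p-q∣≡∣q-p∣ p q = trans (sym (ℚ.∣-p∣≡∣p∣ (p - q)))
    (cong ∣_∣ (solve 2 (λ p q → :- (p :- q) := q :- p) refl p q))

  ∣p∣≤∣p-q∣+∣q∣ : ∀ p q → ∣ p ∣ ≤ ∣ p - q ∣ + ∣ q ∣
  ∣p∣≤∣p-q∣+∣q∣ p q = begin
    ∣ p ∣             ≡⟨ cong ∣_∣ (solve 2 (λ p q → p := (p :- q) :+ q) refl p q) ⟩
    ∣ (p - q) + q ∣   ≤⟨ ℚ.∣p+q∣≤∣p∣+∣q∣ (p - q) q ⟩
    ∣ p - q ∣ + ∣ q ∣ ∎

  ∣p∣-∣q∣≤∣p-q∣ : ∀ p q → ∣ p ∣ - ∣ q ∣ ≤ ∣ p - q ∣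
  ∣p∣-∣q∣≤∣p-q∣ p q = begin
    ∣ p ∣ - ∣ q ∣               ≤⟨ ℚ.+-monoˡ-≤ (- ∣ q ∣) (∣p∣≤∣p-q∣+∣q∣ p q) ⟩
    ∣ p - q ∣ + ∣ q ∣ - ∣ q ∣   ≡⟨ solve 2 (λ a b → a :+ b :- b := a) refl ∣ p - q ∣ ∣ q ∣ ⟩
    ∣ p - q ∣                   ∎

  ∣∣p∣-∣q∣∣≤∣p-q∣ : ∀ p q → ∣ ∣ p ∣ - ∣ q ∣ ∣ ≤ ∣ p - q ∣
  ∣∣p∣-∣q∣∣≤∣p-q∣ p q = ∣-∣-≤ (∣p∣-∣q∣≤∣p-q∣ p q) (begin
    - (∣ p ∣ - ∣ q ∣) ≡⟨ solve 2 (λ a b → :- (a :- b) := b :- a) refl ∣ p ∣ ∣ q ∣ ⟩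
    ∣ q ∣ - ∣ p ∣     ≤⟨ ∣p∣-∣q∣≤∣p-q∣ q p ⟩
    ∣ q - p ∣         ≡⟨ ∣p-q∣≡∣q-p∣ q p ⟩
    ∣ p - q ∣         ∎)

  *-pos : ∀ {p q} → 0ℚ < p → 0ℚ < q → 0ℚ < p * q
  *-pos {p} {q} 0<p 0<q = subst (_< p * q) (ℚ.*-zeroˡ q)
    (ℚ.*-monoˡ-<-pos q {{positive 0<q}} 0<p)

  *-mono-≤-0 : ∀ {a b c d} → 0ℚ ≤ b → 0ℚ ≤ c → a ≤ c → b ≤ d → a * b ≤ c * d
  *-mono-≤-0 {a} {b} {c} {d} 0≤b 0≤c a≤c b≤d = ℚ.≤-trans
    (ℚ.*-monoʳ-≤-nonNeg b {{nonNegative 0≤b}} a≤c)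
    (ℚ.*-monoˡ-≤-nonNeg c {{nonNegative 0≤c}} b≤d)

  ε½ : ∀ {ε} → 0ℚ < ε → 0ℚ < ε * ½
  ε½ 0<ε = *-pos 0<ε (ℚ.positive⁻¹ ½)

  +-interchange-minus : ∀ a b c d → (a + b) - (c + d) ≡ (a - c) + (b - d)
  +-interchange-minus = solve 4 (λ a b c d → (a :+ b) :- (c :+ d) := (a :- c) :+ (b :- d)) refl

  neg-minus : ∀ a b → - (a - b) ≡ - a - - b
  neg-minus = solve 2 (λ a b → :- (a :- b) := :- a :- :- b) refl

  *-minus-* : ∀ a b c d → a * b - c * d ≡ a * (b - d) + (a - c) * d
  *-minus-* = solve 4 (λ a b c d → a :* b :- c :* d := a :* (b :- d) :+ (a :- c) :* d) refl

  *-factor : ∀ A B δ → A * δ + δ * B ≡ δ * (A + B)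
  *-factor = solve 3 (λ A B δ → A :* δ :+ δ :* B := δ :* (A :+ B)) refl

  clear-recip : ∀ p q p′ q′ → (p′ - q′) * (p * q) ≡ (p′ * p) * q - (q′ * q) * p
  clear-recip = solve 4 (λ p q p′ q′ → (p′ :- q′) :* (p :* q) := (p′ :* p) :* q :- (q′ :* q) :* p) refl

  ½+½ : ∀ ε → ε * ½ + ε * ½ ≡ ε
  ½+½ = solve 1 (λ e → e :* con ½ :+ e :* con ½ := e) refl

  shrink : ∀ ε c → 0ℚ < ε → 0ℚ < c → Σ[ δ ∈ ℚ ] 0ℚ < δ × δ * c ≡ ε
  shrink ε c 0<ε 0<c = ε * 1/c , *-pos 0<ε 0<1/c , eq
    where
    instance
      c≢0 : ℚ.NonZero c
      c≢0 = ℚ.pos⇒nonZero c {{positive 0<c}}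
    1/c = ℚ.1/ c
    0<1/c : 0ℚ < 1/c
    0<1/c = ℚ.positive⁻¹ 1/c {{ℚ.1/pos⇒pos c {{positive 0<c}}}}
    eq : ε * 1/c * c ≡ ε
    eq = trans (ℚ.*-assoc ε 1/c c) (trans (cong (ε *_) (ℚ.*-inverseˡ c)) (ℚ.*-identityʳ ε))

  *-close : ∀ a b c d A B δ → 0ℚ < A → 0ℚ < δ → ∣ a ∣ ≤ A → ∣ d ∣ ≤ B →
            ∣ a - c ∣ < δ → ∣ b - d ∣ < δ → ∣ a * b - c * d ∣ < δ * (A + B)
  *-close a b c d A B δ 0<A 0<δ a≤A d≤B a-c<δ b-d<δ = begin-strict
    ∣ a * b - c * d ∣                     ≡⟨ cong ∣_∣ (*-minus-* a b c d) ⟩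
    ∣ a * (b - d) + (a - c) * d ∣         ≤⟨ ℚ.∣p+q∣≤∣p∣+∣q∣ (a * (b - d)) ((a - c) * d) ⟩
    ∣ a * (b - d) ∣ + ∣ (a - c) * d ∣     ≡⟨ cong₂ _+_ (ℚ.∣p*q∣≡∣p∣*∣q∣ a (b - d)) (ℚ.∣p*q∣≡∣p∣*∣q∣ (a - c) d) ⟩
    ∣ a ∣ * ∣ b - d ∣ + ∣ a - c ∣ * ∣ d ∣ ≤⟨ ℚ.+-mono-≤ left right ⟩
    A * ∣ b - d ∣ + δ * B
      <⟨ ℚ.+-monoˡ-< (δ * B) (ℚ.*-monoʳ-<-pos A {{positive 0<A}} b-d<δ) ⟩
    A * δ + δ * B                         ≡⟨ *-factor A B δ ⟩
    δ * (A + B)                           ∎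
    where
    left : ∣ a ∣ * ∣ b - d ∣ ≤ A * ∣ b - d ∣
    left = ℚ.*-monoʳ-≤-nonNeg ∣ b - d ∣ {{ℚ.∣-∣-nonNeg (b - d)}} a≤A
    right : ∣ a - c ∣ * ∣ d ∣ ≤ δ * B
    right = *-mono-≤-0 (ℚ.0≤∣p∣ d) (ℚ.<⇒≤ 0<δ) (ℚ.<⇒≤ a-c<δ) d≤B

  1/-fromℕ : ∀ n .{{_ : ℕ.NonZero n}} → (+ 1 ℚ./ n) * fromℕ n ≡ 1ℚ
  1/-fromℕ n@(suc k) = ℚ.toℚᵘ-injective (ℚᵘ.≃-trans (ℚ.toℚᵘ-homo-* (+ 1 ℚ./ n) (fromℕ n))
    (ℚᵘ.≃-trans (ℚᵘ.*-cong (ℚ.toℚᵘ-fromℚᵘ (ℚᵘ.mkℚᵘ (+ 1) k)) (ℚ.toℚᵘ-fromℚᵘ (ℚᵘ.mkℚᵘ (+ n) 0)))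
    (ℚᵘ.*≡* (trans (ℤ.*-identityʳ (+ 1 ℤ.* + n))
      (cong (λ m → + 1 ℤ.* + m) (sym (ℕ.*-identityʳ n)))))))

  fromℕ-* : ∀ m n → fromℕ (m ℕ.* n) ≡ fromℕ m * fromℕ n
  fromℕ-* m n = ℚ.toℚᵘ-injective (ℚᵘ.≃-trans (ℚ.toℚᵘ-fromℚᵘ (ℚᵘ.mkℚᵘ (+ (m ℕ.* n)) 0))
    (ℚᵘ.≃-sym (ℚᵘ.≃-trans (ℚ.toℚᵘ-homo-* (fromℕ m) (fromℕ n))
    (ℚᵘ.≃-trans (ℚᵘ.*-cong (ℚ.toℚᵘ-fromℚᵘ (ℚᵘ.mkℚᵘ (+ m) 0)) (ℚ.toℚᵘ-fromℚᵘ (ℚᵘ.mkℚᵘ (+ n) 0)))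
    (ℚᵘ.*≡* (cong (ℤ._* + 1) (sym (ℤ.pos-* m n))))))))

  fromℕ-mono-≤ : ∀ {m n} → m ℕ.≤ n → fromℕ m ≤ fromℕ n
  fromℕ-mono-≤ {m} {n} m≤n = ℚ.toℚᵘ-cancel-≤
    (ℚᵘ.≤-respˡ-≃ (ℚᵘ.≃-sym (ℚ.toℚᵘ-fromℚᵘ (ℚᵘ.mkℚᵘ (+ m) 0)))
    (ℚᵘ.≤-respʳ-≃ (ℚᵘ.≃-sym (ℚ.toℚᵘ-fromℚᵘ (ℚᵘ.mkℚᵘ (+ n) 0)))
    (ℚᵘ.*≤* (ℤ.*-monoʳ-≤-nonNeg (+ 1) (ℤ.+≤+ m≤n)))))

  archimedean : ∀ ε → 0ℚ < ε → ∃ λ d → 1ℚ ≤ ε * fromℕ d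
  archimedean ε@(mkℚ +[1+ a ] k _) _ = suc k , (begin
    1ℚ                                ≡⟨ 1/-fromℕ (suc k) ⟨
    (+ 1 ℚ./ suc k) * fromℕ (suc k)   ≤⟨ ℚ.*-monoʳ-≤-nonNeg (fromℕ (suc k)) {{nonNegative (fromℕ-mono-≤ {0} {suc k} ℕ.z≤n)}} 1/d≤ε ⟩
    ε * fromℕ (suc k)                 ∎)
    where
    1/d≤ε : + 1 ℚ./ suc k ≤ ε
    1/d≤ε = ℚ.toℚᵘ-cancel-≤ (ℚᵘ.≤-respˡ-≃ (ℚᵘ.≃-sym (ℚ.toℚᵘ-fromℚᵘ (ℚᵘ.mkℚᵘ (+ 1) k)))
      (ℚᵘ.*≤* (ℤ.*-monoʳ-≤-nonNeg (+ suc k) (ℤ.+≤+ {1} {suc a} (ℕ.s≤s ℕ.z≤n)))))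
  archimedean (mkℚ (+ 0) _ _)      (ℚ.*<* (ℤ.+<+ ()))
  archimedean (mkℚ ℤ.-[1+ _ ] _ _) (ℚ.*<* ())

IsCauchy : (ℕ → ℚ) → Set
IsCauchy s = ∀ ε → 0ℚ ℚ.< ε →
  ∃[ N ] ∀ m n → N ℕ.≤ m → N ℕ.≤ n → ℚ.∣ s m ℚ.- s n ∣ ℚ.< ε

record ℝ : Set where
  field
    seq    : ℕ → ℚ
    cauchy : IsCauchy seq

open ℝ

module ℝ-Operations where
  open ℚ-Lemmas
  open import Data.Rational.Base using (_+_; _*_; _-_; -_; ∣_∣; _≤_; _<_; nonNegative; positive)
  open +-*-Solver using (solve; _:=_; _:+_; _:*_; _:-_; :-_; con)
  open ℚ.≤-Reasoning

  fromℚ : ℚ → ℝ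
  fromℚ q .seq _ = q
  fromℚ q .cauchy ε 0<ε = 0 , λ _ _ _ _ → subst (_< ε) (sym (cong ∣_∣ (ℚ.+-inverseʳ q))) 0<ε

  negate : ℝ → ℝ
  negate x .seq n = - seq x n
  negate x .cauchy ε 0<ε with cauchy x ε 0<ε
  ... | N , h = N , λ m n N≤m N≤n → subst (_< ε)
    (trans (sym (ℚ.∣-p∣≡∣p∣ (seq x m - seq x n)))
      (cong ∣_∣ (neg-minus (seq x m) (seq x n))))
    (h m n N≤m N≤n)

  add : ℝ → ℝ → ℝ
  add x y .seq n = seq x n + seq y n
  add x y .cauchy ε 0<ε with cauchy x (ε * ½) (ε½ 0<ε) | cauchy y (ε * ½) (ε½ 0<ε)
  ... | M , f | N , g = M ℕ.⊔ N , λ m n m≥ n≥ → begin-strict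
    ∣ (seq x m + seq y m) - (seq x n + seq y n) ∣
      ≡⟨ cong ∣_∣ (+-interchange-minus (seq x m) (seq y m) (seq x n) (seq y n)) ⟩
    ∣ (seq x m - seq x n) + (seq y m - seq y n) ∣
      ≤⟨ ℚ.∣p+q∣≤∣p∣+∣q∣ (seq x m - seq x n) (seq y m - seq y n) ⟩
    ∣ seq x m - seq x n ∣ + ∣ seq y m - seq y n ∣
      <⟨ ℚ.+-mono-< (f m n (ℕ.m⊔n≤o⇒m≤o M N m≥) (ℕ.m⊔n≤o⇒m≤o M N n≥))
                    (g m n (ℕ.m⊔n≤o⇒n≤o M N m≥) (ℕ.m⊔n≤o⇒n≤o M N n≥)) ⟩
    ε * ½ + ε * ½ ≡⟨ ½+½ ε ⟩
    ε             ∎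

  abs : ℝ → ℝ
  abs x .seq n = ∣ seq x n ∣
  abs x .cauchy ε 0<ε with cauchy x ε 0<ε
  ... | N , h = N , λ m n N≤m N≤n →
    ℚ.≤-<-trans (∣∣p∣-∣q∣∣≤∣p-q∣ (seq x m) (seq x n)) (h m n N≤m N≤n)

  Bounded : (ℕ → ℚ) → Set
  Bounded s = ∃[ B ] 0ℚ < B × ∃[ N ] ∀ n → N ℕ.≤ n → ∣ s n ∣ ≤ B

  bounded : ∀ x → Bounded (seq x)
  bounded x with cauchy x 1ℚ (ℚ.positive⁻¹ 1ℚ)
  ... | N , h = 1ℚ + ∣ seq x N ∣ ,
    ℚ.+-mono-<-≤ (ℚ.positive⁻¹ 1ℚ) (ℚ.0≤∣p∣ (seq x N)) , N , λ n N≤n → begin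
      ∣ seq x n ∣                         ≤⟨ ∣p∣≤∣p-q∣+∣q∣ (seq x n) (seq x N) ⟩
      ∣ seq x n - seq x N ∣ + ∣ seq x N ∣ ≤⟨ ℚ.+-monoˡ-≤ ∣ seq x N ∣ (ℚ.<⇒≤ (h n N N≤n ℕ.≤-refl)) ⟩
      1ℚ + ∣ seq x N ∣                    ∎

  *-cauchy : (s t : ℕ → ℚ) → Bounded s → Bounded t → IsCauchy s → IsCauchy t →
             IsCauchy (λ n → s n * t n)
  *-cauchy s t (A , 0<A , Ns , fs) (B , 0<B , Nt , ft) cs ct ε 0<ε =
    N , λ m n m≥ n≥ → ℚ.<-≤-trans
      (*-close (s m) (t m) (s n) (t n) A B δ 0<A 0<δ
        (fs m (s₁ m≥)) (ft n (t₁ n≥)) (gs m n (s₂ m≥) (s₂ n≥)) (gt m n (t₂ m≥) (t₂ n≥)))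
      (ℚ.≤-reflexive δ*c≡ε)
    where
    c = shrink ε (A + B) 0<ε (ℚ.+-mono-< 0<A 0<B)
    δ = proj₁ c
    0<δ = proj₁ (proj₂ c)
    δ*c≡ε = proj₂ (proj₂ c)
    Ms = proj₁ (cs δ 0<δ)
    gs = proj₂ (cs δ 0<δ)
    Mt = proj₁ (ct δ 0<δ)
    gt = proj₂ (ct δ 0<δ)
    N = (Ns ℕ.⊔ Nt) ℕ.⊔ (Ms ℕ.⊔ Mt)
    s₁ : ∀ {n} → N ℕ.≤ n → Ns ℕ.≤ n
    s₁ = ℕ.m⊔n≤o⇒m≤o Ns Nt ∘ ℕ.m⊔n≤o⇒m≤o (Ns ℕ.⊔ Nt) (Ms ℕ.⊔ Mt)
    t₁ : ∀ {n} → N ℕ.≤ n → Nt ℕ.≤ n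
    t₁ = ℕ.m⊔n≤o⇒n≤o Ns Nt ∘ ℕ.m⊔n≤o⇒m≤o (Ns ℕ.⊔ Nt) (Ms ℕ.⊔ Mt)
    s₂ : ∀ {n} → N ℕ.≤ n → Ms ℕ.≤ n
    s₂ = ℕ.m⊔n≤o⇒m≤o Ms Mt ∘ ℕ.m⊔n≤o⇒n≤o (Ns ℕ.⊔ Nt) (Ms ℕ.⊔ Mt)
    t₂ : ∀ {n} → N ℕ.≤ n → Mt ℕ.≤ n
    t₂ = ℕ.m⊔n≤o⇒n≤o Ms Mt ∘ ℕ.m⊔n≤o⇒n≤o (Ns ℕ.⊔ Nt) (Ms ℕ.⊔ Mt)

  mul : ℝ → ℝ → ℝ
  mul x y .seq n = seq x n * seq y n
  mul x y .cauchy = *-cauchy (seq x) (seq y) (bounded x) (bounded y) (cauchy x) (cauchy y)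

  infix 4 _<ℝ_
  _<ℝ_ : Rel ℝ _
  x <ℝ y = ∃[ δ ] 0ℚ < δ × ∃[ N ] ∀ n → N ℕ.≤ n → seq x n + δ ≤ seq y n

  0ℝ 1ℝ : ℝ
  0ℝ = fromℚ 0ℚ
  1ℝ = fromℚ 1ℚ

  -- The constructive form of x ≢ 0, as needed for a reciprocal.
  _#0 : ℝ → Set
  x #0 = 0ℝ <ℝ abs x

  -- Totalised by recipℚ 0ℚ = 0ℚ; recip only depends on the values at terms
  -- bounded away from 0.
  recipℚ : ℚ → ℚ
  recipℚ q with q ℚ.≟ 0ℚ
  ... | yes _   = 0ℚ
  ... | no  q≢0 = (ℚ.1/ q) {{ℚ.≢-nonZero q≢0}}

  recipℚ-inverse : ∀ {q} → q ≢ 0ℚ → recipℚ q * q ≡ 1ℚ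
  recipℚ-inverse {q} q≢0 with q ℚ.≟ 0ℚ
  ... | yes q≡0 = ⊥-elim (q≢0 q≡0)
  ... | no  q≢0 = ℚ.*-inverseˡ q {{ℚ.≢-nonZero q≢0}}

  away⇒≢0 : ∀ {δ p} → 0ℚ < δ → δ ≤ ∣ p ∣ → p ≢ 0ℚ
  away⇒≢0 0<δ δ≤0 refl = ℚ.<-irrefl refl (ℚ.<-≤-trans 0<δ δ≤0)

  recipℚ-close : ∀ p q δ ε → 0ℚ < δ → δ ≤ ∣ p ∣ → δ ≤ ∣ q ∣ →
                 ∣ p - q ∣ < ε * (δ * δ) → ∣ recipℚ p - recipℚ q ∣ < ε
  recipℚ-close p q δ ε 0<δ δ≤p δ≤q p-q< =
    ℚ.*-cancelʳ-<-nonNeg (δ * δ) {{nonNegative (ℚ.<⇒≤ (*-pos 0<δ 0<δ))}} (begin-strict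
    D * (δ * δ)               ≤⟨ ℚ.*-monoˡ-≤-nonNeg D {{ℚ.∣-∣-nonNeg (p′ - q′)}} δδ≤pq ⟩
    D * (∣ p ∣ * ∣ q ∣)       ≡⟨ cong (D *_) (ℚ.∣p*q∣≡∣p∣*∣q∣ p q) ⟨
    D * ∣ p * q ∣             ≡⟨ ℚ.∣p*q∣≡∣p∣*∣q∣ (p′ - q′) (p * q) ⟨
    ∣ (p′ - q′) * (p * q) ∣   ≡⟨ cong ∣_∣ (clear-recip p q p′ q′) ⟩
    ∣ (p′ * p) * q - (q′ * q) * p ∣
      ≡⟨ cong₂ (λ s t → ∣ s * q - t * p ∣)
           (recipℚ-inverse (away⇒≢0 0<δ δ≤p)) (recipℚ-inverse (away⇒≢0 0<δ δ≤q)) ⟩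
    ∣ 1ℚ * q - 1ℚ * p ∣       ≡⟨ cong₂ (λ s t → ∣ s - t ∣) (ℚ.*-identityˡ q) (ℚ.*-identityˡ p) ⟩
    ∣ q - p ∣                 ≡⟨ ∣p-q∣≡∣q-p∣ q p ⟩
    ∣ p - q ∣                 <⟨ p-q< ⟩
    ε * (δ * δ)               ∎)
    where
    p′ = recipℚ p
    q′ = recipℚ q
    D = ∣ p′ - q′ ∣
    δδ≤pq : δ * δ ≤ ∣ p ∣ * ∣ q ∣
    δδ≤pq = *-mono-≤-0 (ℚ.<⇒≤ 0<δ) (ℚ.0≤∣p∣ p) δ≤p δ≤q

  recip-cauchy : ∀ x → x #0 → IsCauchy (λ n → recipℚ (seq x n))
  recip-cauchy x (δ , 0<δ , N , h) ε 0<ε = N ℕ.⊔ M , λ m n m≥ n≥ →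
    recipℚ-close (seq x m) (seq x n) δ ε 0<δ
      (away m (ℕ.m⊔n≤o⇒m≤o N M m≥)) (away n (ℕ.m⊔n≤o⇒m≤o N M n≥))
      (g m n (ℕ.m⊔n≤o⇒n≤o N M m≥) (ℕ.m⊔n≤o⇒n≤o N M n≥))
    where
    c = cauchy x (ε * (δ * δ)) (*-pos 0<ε (*-pos 0<δ 0<δ))
    M = proj₁ c
    g = proj₂ c
    away : ∀ n → N ℕ.≤ n → δ ≤ ∣ seq x n ∣
    away n N≤n = subst (_≤ ∣ seq x n ∣) (ℚ.+-identityˡ δ) (h n N≤n)

  recip : (x : ℝ) → x #0 → ℝ
  recip x x#0 .seq n = recipℚ (seq x n)
  recip x x#0 .cauchy = recip-cauchy x x#0

open ℝ-Operations public using (fromℚ; 0ℝ; 1ℝ; _<ℝ_; _#0; recip)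
open ℝ-Operations public using () renaming (add to infixl 6 _+ℝ_; mul to infixl 7 _*ℝ_; abs to ∣_∣ℝ)

infixl 6 _-ℝ_
_-ℝ_ : ℝ → ℝ → ℝ
x -ℝ y = x +ℝ ℝ-Operations.negate y

infix 4 _⟶_ _∼_

_⟶_ : (ℕ → ℝ) → ℝ → Set
a ⟶ L = ∀ ε → 0ℝ <ℝ ε → ∃[ N ] ∀ n → N ℕ.≤ n → ∣ a n -ℝ L ∣ℝ <ℝ ε

-- The first component says that the ratio is defined, the second that it
-- tends to 1.
_∼_ : (ℕ → ℝ) → (ℕ → ℝ) → Set
a ∼ b = Σ[ b#0 ∈ (∀ n → b n #0) ] (λ n → a n *ℝ recip (b n) (b#0 n)) ⟶ 1ℝ

module Euler where
  open ℚ-Lemmas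
  open import Data.Rational.Base using (_+_; _*_; _-_; -_; ∣_∣; _≤_; _<_; nonNegative; positive)
  open +-*-Solver using (solve; _:=_; _:+_; _:*_; _:-_; :-_; con)
  open ℚ.≤-Reasoning

  s : ℕ → ℚ
  s n = ∑[ j < n ] 1/ j !

  2ℚ = 1ℚ + 1ℚ

  fact-pos : ∀ n → 0ℚ < fromℕ (n !)
  fact-pos n = ℚ.<-≤-trans (ℚ.positive⁻¹ 1ℚ) (fromℕ-mono-≤ (ℕ.1≤n! n))

  1/!-fact : ∀ n → 1/ n ! * fromℕ (n !) ≡ 1ℚ
  1/!-fact n = 1/-fromℕ (n !) {{n !≢0}}

  1/!-nonNeg : ∀ n → 0ℚ ≤ 1/ n !
  1/!-nonNeg n = ℚ.nonNegative⁻¹ (1/ n !) {{ℚ.normalize-nonNeg 1 (n !) {{n !≢0}}}}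

  1/!-step : ∀ n → 1/ suc n ! * fromℕ (suc n) ≡ 1/ n !
  1/!-step n = ℚ.≤-antisym (ℚ.*-cancelʳ-≤-pos f (ℚ.≤-reflexive eq)) (ℚ.*-cancelʳ-≤-pos f (ℚ.≤-reflexive (sym eq)))
    where
    f = fromℕ (n !)
    instance
      f-pos : ℚ.Positive f
      f-pos = positive (fact-pos n)
    eq : 1/ suc n ! * fromℕ (suc n) * f ≡ 1/ n ! * f
    eq = begin-equality
      1/ suc n ! * fromℕ (suc n) * f    ≡⟨ ℚ.*-assoc (1/ suc n !) (fromℕ (suc n)) f ⟩
      1/ suc n ! * (fromℕ (suc n) * f)  ≡⟨ cong (1/ suc n ! *_) (fromℕ-* (suc n) (n !)) ⟨
      1/ suc n ! * fromℕ (suc n !)      ≡⟨ 1/!-fact (suc n) ⟩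
      1ℚ                                ≡⟨ 1/!-fact n ⟨
      1/ n ! * f                        ∎

  halving : ∀ n → 1/ suc (suc n) ! * 2ℚ ≤ 1/ suc n !
  halving n = begin
    1/ suc (suc n) ! * 2ℚ
      ≤⟨ ℚ.*-monoˡ-≤-nonNeg (1/ suc (suc n) !) {{nonNegative (1/!-nonNeg (suc (suc n)))}}
           (fromℕ-mono-≤ {2} {suc (suc n)} (ℕ.s≤s (ℕ.s≤s ℕ.z≤n))) ⟩
    1/ suc (suc n) ! * fromℕ (suc (suc n)) ≡⟨ 1/!-step (suc n) ⟩
    1/ suc n !                             ∎

  1/!≤1 : ∀ n → 1/ n ! ≤ 1ℚ
  1/!≤1 zero    = ℚ.≤-refl
  1/!≤1 (suc n) = begin
    1/ suc n !                 ≡⟨ ℚ.*-identityʳ (1/ suc n !) ⟨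
    1/ suc n ! * 1ℚ
      ≤⟨ ℚ.*-monoˡ-≤-nonNeg (1/ suc n !) {{nonNegative (1/!-nonNeg (suc n))}}
           (fromℕ-mono-≤ {1} {suc n} (ℕ.s≤s ℕ.z≤n)) ⟩
    1/ suc n ! * fromℕ (suc n) ≡⟨ 1/!-step n ⟩
    1/ n !                     ≤⟨ 1/!≤1 n ⟩
    1ℚ                         ∎

  -- s increases while s n + 2 / n! decreases.
  s-mono : ∀ k n → s n ≤ s (k ℕ.+ n)
  s-mono zero    n = ℚ.≤-refl
  s-mono (suc k) n = begin
    s n                                ≤⟨ s-mono k n ⟩
    s (k ℕ.+ n)                        ≡⟨ ℚ.+-identityʳ (s (k ℕ.+ n)) ⟨
    s (k ℕ.+ n) + 0ℚ                   ≤⟨ ℚ.+-monoʳ-≤ (s (k ℕ.+ n)) (1/!-nonNeg (k ℕ.+ n)) ⟩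
    s (k ℕ.+ n) + 1/ (k ℕ.+ n) !       ∎

  upper : ℕ → ℚ
  upper n = s n + 1/ n ! * 2ℚ

  upper-step : ∀ n → upper (suc (suc n)) ≤ upper (suc n)
  upper-step n = begin
    s (suc n) + t + 1/ suc (suc n) ! * 2ℚ  ≤⟨ ℚ.+-monoʳ-≤ (s (suc n) + t) (halving n) ⟩
    s (suc n) + t + t                      ≡⟨ solve 2 (λ s t → s :+ t :+ t := s :+ t :* con 2ℚ) refl (s (suc n)) t ⟩
    s (suc n) + t * 2ℚ                     ∎
    where t = 1/ suc n !

  upper-anti : ∀ k n → upper (k ℕ.+ suc n) ≤ upper (suc n)
  upper-anti zero    n = ℚ.≤-refl
  upper-anti (suc k) n = ℚ.≤-trans
    (subst (λ m → upper (suc m) ≤ upper m) (sym (ℕ.+-suc k n)) (upper-step (k ℕ.+ n)))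
    (upper-anti k n)

  tail : ∀ n m → suc n ℕ.≤ m → ∣ s m - s (suc n) ∣ ≤ 1/ suc n ! * 2ℚ
  tail n m n<m = subst (λ m → ∣ s m - s (suc n) ∣ ≤ 1/ suc n ! * 2ℚ) (ℕ.m∸n+n≡m n<m)
    (∣-∣-≤ above below)
    where
    k = m ℕ.∸ suc n
    a = s (k ℕ.+ suc n)
    b = s (suc n)
    t = 1/ suc n ! * 2ℚ
    0≤2t : ∀ n → 0ℚ ≤ 1/ n ! * 2ℚ
    0≤2t n = ℚ.≤-trans (ℚ.≤-reflexive (sym (ℚ.*-zeroˡ 2ℚ))) (ℚ.*-monoʳ-≤-nonNeg 2ℚ (1/!-nonNeg n))
    above : a - b ≤ t
    above = begin
      a - b            ≡⟨ solve 2 (λ a b → a :- b := a :+ con 0ℚ :- b) refl a b ⟩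
      a + 0ℚ - b       ≤⟨ ℚ.+-monoˡ-≤ (- b) (ℚ.+-monoʳ-≤ a (0≤2t (k ℕ.+ suc n))) ⟩
      upper (k ℕ.+ suc n) - b ≤⟨ ℚ.+-monoˡ-≤ (- b) (upper-anti k n) ⟩
      b + t - b        ≡⟨ solve 2 (λ b t → b :+ t :- b := t) refl b t ⟩
      t                ∎
    below : - (a - b) ≤ t
    below = begin
      - (a - b)        ≡⟨ solve 2 (λ a b → :- (a :- b) := b :- a) refl a b ⟩
      b - a            ≤⟨ ℚ.+-monoˡ-≤ (- a) (s-mono k (suc n)) ⟩
      a - a            ≡⟨ ℚ.+-inverseʳ a ⟩
      0ℚ               ≤⟨ 0≤2t (suc n) ⟩
      t                ∎

  -- The base of the natural logarithm, as the sum of the series ∑ 1/j!.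
  e : ℝ
  e .seq = s
  e .cauchy ε 0<ε with shrink ε (fromℕ 6) 0<ε (ℚ.positive⁻¹ (fromℕ 6))
  ... | δ , 0<δ , eq with archimedean δ 0<δ
  ... | d , 1≤δd = suc d , λ m n m≥ n≥ → let
      a = s m ; b = s n ; c = s (suc d) ; t = 1/ suc d !
    in begin-strict
    ∣ a - b ∣              ≡⟨ cong ∣_∣ (solve 3 (λ a b c → a :- b := (a :- c) :- (b :- c)) refl a b c) ⟩
    ∣ (a - c) - (b - c) ∣  ≤⟨ ℚ.∣p-q∣≤∣p∣+∣q∣ (a - c) (b - c) ⟩
    ∣ a - c ∣ + ∣ b - c ∣  ≤⟨ ℚ.+-mono-≤ (tail d m m≥) (tail d n n≥) ⟩
    t * 2ℚ + t * 2ℚ        ≡⟨ solve 1 (λ t → t :* con 2ℚ :+ t :* con 2ℚ := t :* con (fromℕ 4)) refl t ⟩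
    t * fromℕ 4            ≤⟨ ℚ.*-monoʳ-≤-nonNeg (fromℕ 4) t≤δ ⟩
    δ * fromℕ 4            <⟨ ℚ.*-monoʳ-<-pos δ {{positive 0<δ}} (ℚ.*<* (ℤ.+<+ (ℕ.m≤m+n 5 1))) ⟩
    δ * fromℕ 6            ≡⟨ eq ⟩
    ε                      ∎
    where
    D = fromℕ (suc d)
    D-pos : 0ℚ < D
    D-pos = ℚ.<-≤-trans (ℚ.positive⁻¹ 1ℚ) (fromℕ-mono-≤ {1} {suc d} (ℕ.s≤s ℕ.z≤n))
    t≤δ : 1/ suc d ! ≤ δ
    t≤δ = ℚ.*-cancelʳ-≤-pos D {{positive D-pos}} (begin
      1/ suc d ! * D ≡⟨ 1/!-step d ⟩
      1/ d !         ≤⟨ 1/!≤1 d ⟩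
      1ℚ             ≤⟨ 1≤δd ⟩
      δ * fromℕ d    ≤⟨ ℚ.*-monoˡ-≤-nonNeg δ {{nonNegative (ℚ.<⇒≤ 0<δ)}} (fromℕ-mono-≤ (ℕ.n≤1+n d)) ⟩
      δ * D          ∎)

open Euler public using (e)

{-# OPTIONS --safe #-}

-- From u, exactly d(u,v) neighbours are one step closer to v, where d is the
-- Hamming distance, so there are d(u,v)! shortest paths from u to v.  Summing
-- over ordered pairs counts every unordered pair twice and adds a diagonal, so
-- gpn (Q r) = 2^(r-1) (B r - 1) + 2^r with B r = ∑ₖ (r choose k) k!.  Pascal's
-- rule gives B (r + 1) = (r + 1) B r + 1, hence B r - 1 = r! ∑_{j<r} 1/j!.
-- Replacing the partial sum by e changes the result by at most 2^r, which is at
-- most 2/r! times the main term.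
module Submission where

open import Defs
open import Data.Bool.Base using (Bool; true; false; not; _xor_; if_then_else_)
import Data.Bool.Properties as Bool
open import Data.Fin.Base using (zero; suc)
import Data.Fin.Properties as Fin
import Data.Integer.Base as ℤ
import Data.Integer.Properties as ℤ
open import Data.List.Base using (List; []; _∷_; _++_; map; concatMap; length; last; upTo)
import Data.List.Properties as List
open import Data.List.Properties using (length-map; length-++; map-cong; map-∘; map-++; ++-identityʳ)
open import Data.List.Membership.Propositional using (_∈_; find; lose)
open import Data.List.Membership.Propositional.Properties using (∈-map⁺; ∈-map⁻; ∈-concatMap⁺; ∈-concatMap⁻; ∈-filter⁺; ∈-filter⁻; ∈-upTo⁺; ∈-cartesianProductWith⁺; ∈-cartesianProductWith⁻)
open import Data.List.Membership.Propositional.Properties.WithK using (unique∧set⇒bag)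
open import Data.List.Relation.Binary.BagAndSetEquality using (∼bag⇒↭)
open import Data.List.Relation.Binary.Disjoint.Propositional using (Disjoint)
open import Data.List.Relation.Binary.Permutation.Propositional.Properties using (↭-length)
open import Data.List.Relation.Unary.All as All using (All; []; _∷_)
import Data.List.Relation.Unary.All.Properties as All
open import Data.List.Relation.Unary.AllPairs as AllPairs using ([]; _∷_)
import Data.List.Relation.Unary.AllPairs.Properties as AllPairs
open import Data.List.Relation.Unary.Any using (here; there)
open import Data.List.Relation.Unary.Linked using (Linked; [-]; _∷_)
open import Data.List.Relation.Unary.Unique.Propositional using (Unique)
import Data.List.Relation.Unary.Unique.Propositional.Properties as Unique
open import Data.Maybe.Base using (just)
open import Data.Nat.Base using (ℕ; zero; suc; _+_; _*_; _∸_; _^_; _!; _⊔_; _≤_; _<_; z≤n; s≤s; ≢-nonZero⁻¹)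
open import Data.Nat.ListAction using (sum)
open import Data.Nat.ListAction.Properties using (sum-++)
open import Data.Nat.Properties
open import Data.Nat.Tactic.RingSolver using (solve-∀)
open import Data.Product using (∃-syntax; _×_; _,_; proj₂; uncurry)
open import Data.Rational.Base as ℚ using (ℚ; 0ℚ; 1ℚ; ½)
import Data.Rational.Properties as ℚ
open import Data.Rational.Solver using (module +-*-Solver)
import Data.Rational.Unnormalised.Base as ℚᵘ
import Data.Rational.Unnormalised.Properties as ℚᵘ
open import Data.Vec.Base using (Vec; []; _∷_; lookup)
open import Data.Vec.Properties using (∷-injectiveʳ)
open import Data.Vec.Relation.Binary.Pointwise.Extensional using (ext; Pointwise-≡⇒≡)
open import Function.Base using (_∘_; id)
open import Function.Bundles using (mk⇔)
open import Level using (0ℓ)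
open import Relation.Binary.Core using (Rel)
open import Relation.Binary.PropositionalEquality
open import Relation.Nullary.Decidable using (decidable-stable)
open import Relation.Nullary.Negation using (contradiction)

open +-*-Solver using (solve; _:=_; _:+_; _:*_; _:-_; con)
open ℚ-Lemmas
open Euler using (s)
open ℝ using (seq)

private
  variable
    A B : Set

-- Shortest paths in the hypercube

hamming : ∀ {r} → Vec Bool r → Vec Bool r → ℕ
hamming []      []      = 0
hamming (a ∷ u) (b ∷ v) = (if a xor b then suc else id) (hamming u v)

-- Inductive counterpart of `DifferInOne`: the position of the changed bit becomes a derivation, so
-- facts about adjacency can be proved by induction along the coordinates.
data Flip : ∀ {r} → Rel (Vec Bool r) 0ℓ where
  here  : ∀ {r a} {u : Vec Bool r} → Flip (a ∷ u) (not a ∷ u)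
  there : ∀ {r a} {u v : Vec Bool r} → Flip u v → Flip (a ∷ u) (a ∷ v)

Flip⇒DifferInOne : ∀ {r} {u v : Vec Bool r} → Flip u v → DifferInOne u v
Flip⇒DifferInOne {u = a ∷ u} here = zero , Bool.not-¬ refl , λ {j} → only j
  where
  only : ∀ j → lookup (a ∷ u) j ≢ lookup (not a ∷ u) j → zero ≡ j
  only zero    _  = refl
  only (suc j) j≢ = contradiction refl j≢
Flip⇒DifferInOne {u = a ∷ u} {_ ∷ v} (there f) with i , i≢ , !i ← Flip⇒DifferInOne f =
  suc i , i≢ , λ {j} → only j
  where
  only : ∀ j → lookup (a ∷ u) j ≢ lookup (a ∷ v) j → suc i ≡ j
  only zero    0≢ = contradiction refl 0≢
  only (suc j) j≢ = cong suc (!i j≢)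

-- Uniqueness of the differing index forces agreement elsewhere: a second disagreement would
-- identify `zero` with a successor. Decidability of equality on bits turns this refutation into an
-- equality.
DifferInOne⇒Flip : ∀ {r} {u v : Vec Bool r} → DifferInOne u v → Flip u v
DifferInOne⇒Flip {u = a ∷ u} {b ∷ v} (zero , a≢b , !0)
  with refl ← Bool.¬-not (a≢b ∘ sym)
     | refl ← Pointwise-≡⇒≡ {xs = u} {v} (ext λ j → decidable-stable (lookup u j Bool.≟ lookup v j)
                (λ j≢ → contradiction (!0 {suc j} j≢) λ ()))
  = here
DifferInOne⇒Flip {u = a ∷ u} {b ∷ v} (suc i , i≢ , !i)
  with refl ← decidable-stable (a Bool.≟ b) (λ 0≢ → contradiction (!i {zero} 0≢) λ ())
  = there (DifferInOne⇒Flip (i , i≢ , λ {j} j≢ → Fin.suc-injective (!i {suc j} j≢)))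

hamming-refl : ∀ {r} (u : Vec Bool r) → hamming u u ≡ 0
hamming-refl []          = refl
hamming-refl (false ∷ u) = hamming-refl u
hamming-refl (true ∷ u)  = hamming-refl u

hamming-sym : ∀ {r} (u v : Vec Bool r) → hamming u v ≡ hamming v u
hamming-sym []          []          = refl
hamming-sym (false ∷ u) (false ∷ v) = hamming-sym u v
hamming-sym (false ∷ u) (true ∷ v)  = cong suc (hamming-sym u v)
hamming-sym (true ∷ u)  (false ∷ v) = cong suc (hamming-sym u v)
hamming-sym (true ∷ u)  (true ∷ v)  = hamming-sym u v

hamming≡0⇒≡ : ∀ {r} (u v : Vec Bool r) → hamming u v ≡ 0 → u ≡ v
hamming≡0⇒≡ []          []          _  = refl
hamming≡0⇒≡ (false ∷ u) (false ∷ v) eq = cong (false ∷_) (hamming≡0⇒≡ u v eq)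
hamming≡0⇒≡ (true ∷ u)  (true ∷ v)  eq = cong (true ∷_) (hamming≡0⇒≡ u v eq)

hamming≤r : ∀ {r} (u v : Vec Bool r) → hamming u v ≤ r
hamming≤r []          []          = z≤n
hamming≤r (false ∷ u) (false ∷ v) = m≤n⇒m≤1+n (hamming≤r u v)
hamming≤r (false ∷ u) (true ∷ v)  = s≤s (hamming≤r u v)
hamming≤r (true ∷ u)  (false ∷ v) = s≤s (hamming≤r u v)
hamming≤r (true ∷ u)  (true ∷ v)  = m≤n⇒m≤1+n (hamming≤r u v)

-- A flip changes a single coordinate's contribution to the distance. This is what bounds the length
-- of a path from below.
hamming-Flip : ∀ {r} {u w : Vec Bool r} → Flip u w → ∀ v → hamming u v ≤ suc (hamming w v)
hamming-Flip (here {a = false}) (false ∷ v) = m≤n+m _ 2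
hamming-Flip (here {a = false}) (true ∷ v)  = ≤-refl
hamming-Flip (here {a = true})  (false ∷ v) = ≤-refl
hamming-Flip (here {a = true})  (true ∷ v)  = m≤n+m _ 2
hamming-Flip (there {a = false} f) (false ∷ v) = hamming-Flip f v
hamming-Flip (there {a = false} f) (true ∷ v)  = s≤s (hamming-Flip f v)
hamming-Flip (there {a = true} f)  (false ∷ v) = s≤s (hamming-Flip f v)
hamming-Flip (there {a = true} f)  (true ∷ v)  = hamming-Flip f v

-- Each entry corrects one coordinate in which `u` disagrees with `v`; these are the possible second
-- vertices of a geodesic.
closer : ∀ {r} → Vec Bool r → Vec Bool r → List (Vec Bool r)
closer []      []      = []
closer (a ∷ u) (b ∷ v) = (if a xor b then ((b ∷ u) ∷_) else id) (map (a ∷_) (closer u v))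

length-closer : ∀ {r} (u v : Vec Bool r) → length (closer u v) ≡ hamming u v
length-closer []          []          = refl
length-closer (false ∷ u) (false ∷ v) = trans (length-map _ (closer u v)) (length-closer u v)
length-closer (false ∷ u) (true ∷ v)  = cong suc (trans (length-map _ (closer u v)) (length-closer u v))
length-closer (true ∷ u)  (false ∷ v) = cong suc (trans (length-map _ (closer u v)) (length-closer u v))
length-closer (true ∷ u)  (true ∷ v)  = trans (length-map _ (closer u v)) (length-closer u v)

closer-sound : ∀ {r} (u v : Vec Bool r) {w} → w ∈ closer u v →
               Flip u w × suc (hamming w v) ≡ hamming u v
closer-sound []          []          ()
closer-sound (false ∷ u) (false ∷ v) w∈
  with _ , w∈ , refl ← ∈-map⁻ _ w∈ with f , eq ← closer-sound u v w∈ = there f , eq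
closer-sound (false ∷ u) (true ∷ v)  (here refl) = here , refl
closer-sound (false ∷ u) (true ∷ v)  (there w∈)
  with _ , w∈ , refl ← ∈-map⁻ _ w∈ with f , eq ← closer-sound u v w∈ = there f , cong suc eq
closer-sound (true ∷ u)  (false ∷ v) (here refl) = here , refl
closer-sound (true ∷ u)  (false ∷ v) (there w∈)
  with _ , w∈ , refl ← ∈-map⁻ _ w∈ with f , eq ← closer-sound u v w∈ = there f , cong suc eq
closer-sound (true ∷ u)  (true ∷ v)  w∈
  with _ , w∈ , refl ← ∈-map⁻ _ w∈ with f , eq ← closer-sound u v w∈ = there f , eq

closer-complete : ∀ {r} {u w : Vec Bool r} → Flip u w → ∀ v →
                  suc (hamming w v) ≡ hamming u v → w ∈ closer u v
-- Flipping a bit that already agrees moves away from `v`, so `eq` would make a number equal to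
-- itself plus two.
closer-complete (here {a = false}) (false ∷ v) eq = contradiction (sym eq) (m≢1+n+m _ {1})
closer-complete (here {a = false}) (true ∷ v)  _  = here refl
closer-complete (here {a = true})  (false ∷ v) _  = here refl
closer-complete (here {a = true})  (true ∷ v)  eq = contradiction (sym eq) (m≢1+n+m _ {1})
closer-complete (there {a = false} f) (false ∷ v) eq = ∈-map⁺ _ (closer-complete f v eq)
closer-complete (there {a = false} f) (true ∷ v)  eq = there (∈-map⁺ _ (closer-complete f v (suc-injective eq)))
closer-complete (there {a = true} f)  (false ∷ v) eq = there (∈-map⁺ _ (closer-complete f v (suc-injective eq)))
closer-complete (there {a = true} f)  (true ∷ v)  eq = ∈-map⁺ _ (closer-complete f v eq)

closer-unique : ∀ {r} (u v : Vec Bool r) → Unique (closer u v)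
closer-unique []          []          = []
closer-unique (false ∷ u) (false ∷ v) = Unique.map⁺ ∷-injectiveʳ (closer-unique u v)
closer-unique (false ∷ u) (true ∷ v)  =
  -- The neighbour with corrected head differs from all the others, which keep the head of `u`.
  All.map⁺ (All.universal (λ _ ()) _) ∷ Unique.map⁺ ∷-injectiveʳ (closer-unique u v)
closer-unique (true ∷ u)  (false ∷ v) =
  All.map⁺ (All.universal (λ _ ()) _) ∷ Unique.map⁺ ∷-injectiveʳ (closer-unique u v)
closer-unique (true ∷ u)  (true ∷ v)  = Unique.map⁺ ∷-injectiveʳ (closer-unique u v)

-- The argument `d` drives the recursion and is meant to be `hamming u v`. At zero the single vertex
-- `u` is a path to `v` only under that assumption, hence the hypothesis `hamming u v ≡ d` in the
-- lemmas on counts and endpoints.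
geodesics : ∀ {r} → ℕ → Vec Bool r → Vec Bool r → List (List (Vec Bool r))
geodesics zero    u v = (u ∷ []) ∷ []
geodesics (suc d) u v = map (u ∷_) (concatMap (λ w → geodesics d w v) (closer u v))

length-concatMap : ∀ (f : A → List B) {c} xs →
                   (∀ {x} → x ∈ xs → length (f x) ≡ c) → length (concatMap f xs) ≡ length xs * c
length-concatMap f []       _  = refl
length-concatMap f (x ∷ xs) eq = trans (length-++ (f x))
  (cong₂ _+_ (eq (here refl)) (length-concatMap f xs (eq ∘ there)))

-- There are `suc d` choices for the first step, and each leaves a target at distance `d`; the
-- product of the choices is the factorial.
length-geodesics : ∀ {r} d (u v : Vec Bool r) → hamming u v ≡ d → length (geodesics d u v) ≡ d !
length-geodesics zero    u v _  = refl
length-geodesics (suc d) u v eq = begin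
  length (map (u ∷_) (concatMap _ (closer u v))) ≡⟨ length-map _ (concatMap _ (closer u v)) ⟩
  length (concatMap (λ w → geodesics d w v) (closer u v))
    ≡⟨ length-concatMap _ (closer u v) (λ w∈ → length-geodesics d _ v
         (suc-injective (trans (proj₂ (closer-sound u v w∈)) eq))) ⟩
  length (closer u v) * d ! ≡⟨ cong (_* d !) (trans (length-closer u v) eq) ⟩
  suc d !                   ∎
  where open ≡-Reasoning

concatMap-unique : ∀ (f : A → List B) {xs} → Unique xs → (∀ x → Unique (f x)) →
                   (∀ {x y} → x ≢ y → Disjoint (f x) (f y)) → Unique (concatMap f xs)
concatMap-unique f xs! f! f# =
  Unique.concat⁺ (All.map⁺ (All.universal f! _)) (AllPairs.map⁺ (AllPairs.map f# xs!))

-- A geodesic determines its starting vertex, so the lists belonging to different first steps are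
-- disjoint in `geodesics-unique`.
geodesics-head : ∀ {r} d {u v : Vec Bool r} {p} → p ∈ geodesics d u v → ∃[ p′ ] p ≡ u ∷ p′
geodesics-head zero    (here refl) = [] , refl
geodesics-head (suc d) p∈ with p′ , _ , refl ← ∈-map⁻ _ p∈ = p′ , refl

geodesics-unique : ∀ {r} d (u v : Vec Bool r) → Unique (geodesics d u v)
geodesics-unique zero    u v = [] ∷ []
geodesics-unique (suc d) u v = Unique.map⁺ List.∷-injectiveʳ
  (concatMap-unique (λ w → geodesics d w v) (closer-unique u v) (λ w → geodesics-unique d w v) disjoint)
  where
  disjoint : ∀ {w x} → w ≢ x → Disjoint (geodesics d w v) (geodesics d x v)
  disjoint w≢x (p∈w , p∈x) with _ , refl ← geodesics-head d p∈w | _ , refl ← geodesics-head d p∈x = w≢x refl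

module _ {r : ℕ} where
  private
    G = Q r
    variable
      u v : Vec Bool r
      p : List (Vec Bool r)

  -- The distance to v strictly decreases along a geodesic, so no vertex repeats.
  geodesics-sound : ∀ d → hamming u v ≡ d → p ∈ geodesics d u v →
                    ∃[ q ] p ≡ u ∷ q × length q ≡ d × last p ≡ just v × Linked DifferInOne p
                         × Unique p × All (λ w → hamming w v < d) q
  geodesics-sound {u} {v} zero eq (here refl) =
    [] , refl , refl , cong just (hamming≡0⇒≡ u v eq) , [-] , [] ∷ [] , []
  geodesics-sound {u} {v} (suc d) eq p∈
    with _ , p∈ , refl ← ∈-map⁻ _ p∈
    with w , w∈ , p∈ ← find (∈-concatMap⁻ (λ w → geodesics d w v) p∈)
    with u~w , eq′ ← closer-sound u v w∈
    with eqw ← suc-injective (trans eq′ eq)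
    with q , refl , len , lst , lnk , unq , dec ← geodesics-sound {w} d eqw p∈
    = w ∷ q , refl , cong suc len , lst , Flip⇒DifferInOne u~w ∷ lnk , All.map u≢ dec′ ∷ unq , dec′
    where
    dec′ : All (λ x → hamming x v < suc d) (w ∷ q)
    dec′ = s≤s (≤-reflexive eqw) ∷ All.map m<n⇒m<1+n dec
    u≢ : ∀ {x} → hamming x v < suc d → u ≢ x
    u≢ x< refl = <-irrefl eq x<

  -- By `hamming-Flip` every edge accounts for at most one unit of distance. As `p` omits the
  -- starting vertex, its length counts edges.
  hamming≤length : Linked DifferInOne (u ∷ p) → last (u ∷ p) ≡ just v → hamming u v ≤ length p
  hamming≤length {u} [-] refl = ≤-reflexive (hamming-refl u)
  hamming≤length {u} {v = v} (_∷_ {y = w} u~w lnk) lst =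
    ≤-trans (hamming-Flip (DifferInOne⇒Flip {u = u} {w} u~w) v) (s≤s (hamming≤length {w} lnk lst))

  geodesics-complete : ∀ d → hamming u v ≡ d → length p ≡ d → Linked DifferInOne (u ∷ p) →
                       last (u ∷ p) ≡ just v → u ∷ p ∈ geodesics d u v
  geodesics-complete zero eq len [-] lst = here refl
  geodesics-complete {u} {v} (suc d) eq len (_∷_ {y = w} u~w lnk) lst =
    ∈-map⁺ _ (∈-concatMap⁺ (λ w → geodesics d w v) (lose
      (closer-complete flip v (trans (cong suc eqw) (sym eq)))
      (geodesics-complete {w} d eqw (suc-injective len) lnk lst)))
    where
    flip = DifferInOne⇒Flip {u = u} {w} u~w
    eqw : hamming w v ≡ d
    -- The remaining `d` edges bound the distance from `w` above by `d`; the edge just taken lowers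
    -- the distance by at most one, which bounds it below by `d`. A walk of minimal length thus
    -- wastes no step.
    eqw = ≤-antisym (≤-trans (hamming≤length {w} lnk lst) (≤-reflexive (suc-injective len)))
                    (≤-pred (≤-trans (≤-reflexive (sym eq)) (hamming-Flip flip v)))

  -- Here `p` lists all vertices, one more than its edges, whence the strict inequality.
  hamming<length : IsPath G u v p → hamming u v < length p
  hamming<length {u} {p = _ ∷ _} (refl , lst , lnk , _) = s≤s (hamming≤length {u} lnk lst)

  IsPath⇒∈geodesics : IsPath G u v p → length p ≡ suc (hamming u v) → p ∈ geodesics (hamming u v) u v
  IsPath⇒∈geodesics {u} {p = _ ∷ _} (refl , lst , lnk , _) len =
    geodesics-complete {u} _ refl (suc-injective len) lnk lst

  ∈geodesics⇒IsPath : p ∈ geodesics (hamming u v) u v → IsPath G u v p × length p ≡ suc (hamming u v)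
  ∈geodesics⇒IsPath {u = u} {v} p∈
    with q , refl , len , lst , lnk , unq , _ ← geodesics-sound (hamming u v) refl p∈ =
    (refl , lst , lnk , unq) , cong suc len

-- Exhaustive path lists and the number of shortest paths

∈-words⁺ : ∀ {xs ys : List A} → (∀ y → y ∈ xs) → ys ∈ words xs (length ys)
∈-words⁺ {ys = []}     all = here refl
∈-words⁺ {ys = y ∷ ys} all = ∈-cartesianProductWith⁺ _∷_ (all y) (∈-words⁺ all)

∈-words⁻ : ∀ {xs ys : List A} k → ys ∈ words xs k → length ys ≡ k
∈-words⁻ zero (here refl) = refl
∈-words⁻ {xs = xs} (suc k) ys∈
  with _ , _ , _ , ys∈ , refl ← ∈-cartesianProductWith⁻ _∷_ xs (words xs k) ys∈ = cong suc (∈-words⁻ k ys∈)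

words-unique : ∀ {xs : List A} → Unique xs → ∀ k → Unique (words xs k)
words-unique xs! zero    = [] ∷ []
words-unique xs! (suc k) = Unique.cartesianProductWith⁺ _∷_ List.∷-injective xs! (words-unique xs! k)

module _ (G : FiniteSimpleGraph) where
  open FiniteSimpleGraph G

  ∈-paths⁺ : ∀ {u v p} → length p ≤ order G → IsPath G u v p → p ∈ paths G u v
  ∈-paths⁺ {u} {v} p≤ path = ∈-filter⁺ (isPath? G u v)
    (∈-concatMap⁺ (words vertices) (lose (∈-upTo⁺ (s≤s p≤)) (∈-words⁺ complete))) path

  ∈-paths⁻ : ∀ {u v p} → p ∈ paths G u v → IsPath G u v p
  ∈-paths⁻ {u} {v} p∈ = proj₂ (∈-filter⁻ (isPath? G u v) {xs = concatMap (words vertices) (upTo (suc (order G)))} p∈)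

  -- Words of different lengths are distinct, so concatenating over all lengths creates no
  -- repetition, and filtering preserves this.
  shortestPaths-unique : ∀ u v → Unique (shortestPaths G u v)
  shortestPaths-unique u v = Unique.filter⁺ (λ p → All.all? (λ q → length p ≤? length q) (paths G u v)) (Unique.filter⁺ (isPath? G u v)
    (concatMap-unique (words vertices) (Unique.upTo⁺ (suc (order G))) (words-unique unique)
      λ {j} {k} j≢k (∈j , ∈k) → j≢k (trans (sym (∈-words⁻ j ∈j)) (∈-words⁻ k ∈k))))

length-allBits : ∀ r → length (allBits r) ≡ 2 ^ r
length-allBits zero    = refl
length-allBits (suc r) = begin
  length (map (false ∷_) xs ++ map (true ∷_) xs ++ [])
    ≡⟨ length-++ (map (false ∷_) xs) ⟩
  length (map (false ∷_) xs) + length (map (true ∷_) xs ++ [])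
    ≡⟨ cong₂ _+_ (length-map _ xs) (trans (length-++ (map (true ∷_) xs)) (cong (_+ 0) (length-map _ xs))) ⟩
  2 * length xs ≡⟨ cong (2 *_) (length-allBits r) ⟩
  2 ^ suc r     ∎
  where
  open ≡-Reasoning
  xs = allBits r

-- Ensures that a geodesic, with at most `r + 1` vertices, lies within the range of lengths searched
-- by `paths`.
n<2^n : ∀ n → n < 2 ^ n
n<2^n zero    = s≤s z≤n
n<2^n (suc n) = ≤-trans (s≤s (n<2^n n)) (+-mono-≤ (m^n>0 2 n) (≤-reflexive (sym (+-identityʳ _))))

-- Duplicate-free lists with the same members are permutations of each other, so the order of the
-- brute-force search need not be matched.
length-≡-unique : ∀ {xs ys : List A} → Unique xs → Unique ys →
                  (∀ {z} → z ∈ xs → z ∈ ys) → (∀ {z} → z ∈ ys → z ∈ xs) → length xs ≡ length ys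
length-≡-unique xs! ys! xs⊆ys ys⊆xs = ↭-length (∼bag⇒↭ (unique∧set⇒bag xs! ys! (mk⇔ xs⊆ys ys⊆xs)))

gpn-Q : ∀ {r} (u v : Vec Bool r) → gpn⟨_,_⟩ (Q r) u v ≡ hamming u v !
gpn-Q {r} u v = trans (length-≡-unique (shortestPaths-unique G u v) (geodesics-unique d u v) to from)
                      (length-geodesics d u v refl)
  where
  G = Q r
  d = hamming u v
  minimal? = λ p → All.all? (λ q → length p ≤? length q) (paths G u v)

  geodesic∈paths : ∀ {p} → p ∈ geodesics d u v → p ∈ paths G u v
  geodesic∈paths p∈ with path , len ← ∈geodesics⇒IsPath {u = u} {v} p∈ = ∈-paths⁺ G (begin
    _                  ≡⟨ len ⟩
    suc d              ≤⟨ s≤s (hamming≤r u v) ⟩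
    suc r              ≤⟨ n<2^n r ⟩
    2 ^ r              ≡⟨ length-allBits r ⟨
    length (allBits r) ∎) path
    where open ≤-Reasoning

  from : ∀ {p} → p ∈ geodesics d u v → p ∈ shortestPaths G u v
  from p∈ = ∈-filter⁺ minimal? (geodesic∈paths p∈) (All.tabulate λ q∈ →
    ≤-trans (≤-reflexive (proj₂ (∈geodesics⇒IsPath {u = u} {v} p∈))) (hamming<length (∈-paths⁻ G q∈)))

  -- Minimality bounds a path only against paths that exist, so one geodesic has to be exhibited.
  -- The list is not empty because its length `d !` is nonzero.
  geodesic : ∃[ g ] g ∈ geodesics d u v
  geodesic with geodesics d u v | length-geodesics d u v refl
  ... | []    | eq = contradiction (sym eq) (≢-nonZero⁻¹ (d !) {{d !≢0}})
  ... | g ∷ _ | _  = g , here refl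

  to : ∀ {p} → p ∈ shortestPaths G u v → p ∈ geodesics d u v
  to p∈ with p∈ , min ← ∈-filter⁻ minimal? {xs = paths G u v} p∈
        with path ← ∈-paths⁻ G p∈ | g , g∈ ← geodesic
    = IsPath⇒∈geodesics path (≤-antisym
        (≤-trans (All.lookup min (geodesic∈paths g∈)) (≤-reflexive (proj₂ (∈geodesics⇒IsPath {u = u} {v} g∈))))
        (hamming<length path))

-- Summation over pairs of vertices

sum-map-cong : {f g : A → ℕ} → f ≗ g → ∀ xs → sum (map f xs) ≡ sum (map g xs)
sum-map-cong f≗g xs = cong sum (map-cong f≗g xs)

sum-map-+ : (f g : A → ℕ) → ∀ xs → sum (map (λ x → f x + g x) xs) ≡ sum (map f xs) + sum (map g xs)
sum-map-+ f g []       = refl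
sum-map-+ f g (x ∷ xs) = trans (cong (f x + g x +_) (sum-map-+ f g xs))
  (lemma (f x) (g x) (sum (map f xs)) (sum (map g xs)))
  where
  lemma : ∀ a b c d → a + b + (c + d) ≡ a + c + (b + d)
  lemma = solve-∀

sum-map-const : ∀ c (xs : List A) → sum (map (λ _ → c) xs) ≡ length xs * c
sum-map-const c []       = refl
sum-map-const c (_ ∷ xs) = cong (c +_) (sum-map-const c xs)

sum-map-++ : (f : A → ℕ) → ∀ xs ys → sum (map f (xs ++ ys)) ≡ sum (map f xs) + sum (map f ys)
sum-map-++ f xs ys = trans (cong sum (map-++ f xs ys)) (sum-++ (map f xs) (map f ys))

sum-map-∘ : (f : B → ℕ) (g : A → B) → ∀ xs → sum (map f (map g xs)) ≡ sum (map (f ∘ g) xs)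
sum-map-∘ f g xs = cong sum (sym (map-∘ xs))

-- A new element `x` adds a diagonal entry, a row and a column to the square of ordered pairs;
-- symmetry of `f` identifies the column with the row. Doubling the left side avoids a division.
sum-unorderedPairs : (f : A → A → ℕ) → (∀ x y → f x y ≡ f y x) → ∀ xs →
  sum (map (uncurry f) (unorderedPairs xs)) * 2 + sum (map (λ x → f x x) xs)
    ≡ sum (map (λ x → sum (map (f x) xs)) xs)
sum-unorderedPairs f f-sym []       = refl
sum-unorderedPairs f f-sym (x ∷ xs) = begin
  sum (map (uncurry f) (map (x ,_) xs ++ unorderedPairs xs)) * 2 + (f x x + D)
    ≡⟨ cong (λ s → s * 2 + (f x x + D)) (trans (sum-map-++ (uncurry f) (map (x ,_) xs) (unorderedPairs xs))
         (cong (_+ U) (sum-map-∘ (uncurry f) (x ,_) xs))) ⟩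
  (R + U) * 2 + (f x x + D)          ≡⟨ rearrange R U (f x x) D ⟩
  f x x + R + (R + (U * 2 + D))      ≡⟨ cong (λ s → f x x + R + (s + (U * 2 + D))) (sum-map-cong (f-sym x) xs) ⟩
  f x x + R + (sum (map (λ y → f y x) xs) + (U * 2 + D))
    ≡⟨ cong (λ s → f x x + R + (sum (map (λ y → f y x) xs) + s)) (sum-unorderedPairs f f-sym xs) ⟩
  f x x + R + (sum (map (λ y → f y x) xs) + sum (map (λ y → sum (map (f y) xs)) xs))
    ≡⟨ cong (f x x + R +_) (sum-map-+ (λ y → f y x) (λ y → sum (map (f y) xs)) xs) ⟨
  f x x + R + sum (map (λ y → f y x + sum (map (f y) xs)) xs) ∎
  where
  open ≡-Reasoning
  R = sum (map (f x) xs)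
  U = sum (map (uncurry f) (unorderedPairs xs))
  D = sum (map (λ x → f x x) xs)
  rearrange : ∀ r u a d → (r + u) * 2 + (a + d) ≡ a + r + (r + (u * 2 + d))
  rearrange = solve-∀

-- factorialSum r m = ∑ₖ (r choose k) (m + k)!, the shift m turning Pascal's rule
-- into a recursion.
factorialSum : ℕ → ℕ → ℕ
factorialSum zero    m = m !
factorialSum (suc r) m = factorialSum r m + factorialSum r (suc m)

sum-allBits : ∀ {r} (f : Vec Bool (suc r) → ℕ) →
  sum (map f (allBits (suc r))) ≡ sum (map (f ∘ (false ∷_)) (allBits r)) + sum (map (f ∘ (true ∷_)) (allBits r))
sum-allBits {r} f = trans (sum-map-++ f (map (false ∷_) xs) (map (true ∷_) xs ++ []))
  (cong₂ _+_ (sum-map-∘ f (false ∷_) xs)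
    (trans (cong (sum ∘ map f) (++-identityʳ (map (true ∷_) xs))) (sum-map-∘ f (true ∷_) xs)))
  where xs = allBits r

-- Split on the head bit of `v`. One half agrees with `a`; the other is one unit further away, which
-- the shift `m` absorbs. This is the recursion of `factorialSum`, whatever `u` is.
sum-hamming : ∀ {r} (u : Vec Bool r) m → sum (map (λ v → (m + hamming u v) !) (allBits r)) ≡ factorialSum r m
sum-hamming [] m = trans (+-identityʳ _) (cong _! (+-identityʳ m))
sum-hamming {suc r} (a ∷ u) m = trans (sum-allBits (λ v → (m + hamming (a ∷ u) v) !)) (halves a)
  where
  far : sum (map (λ v → (m + suc (hamming u v)) !) (allBits r)) ≡ factorialSum r (suc m)
  far = trans (sum-map-cong (λ v → cong _! (+-suc m (hamming u v))) (allBits r)) (sum-hamming u (suc m))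
  halves : ∀ a → sum (map (λ v → (m + hamming (a ∷ u) (false ∷ v)) !) (allBits r))
               + sum (map (λ v → (m + hamming (a ∷ u) (true ∷ v)) !) (allBits r)) ≡ factorialSum (suc r) m
  halves false = cong₂ _+_ (sum-hamming u m) far
  halves true  = trans (cong₂ _+_ far (sum-hamming u m)) (+-comm (factorialSum r (suc m)) _)

-- Handles the shifted summand that appears when `factorialSum-suc` is unfolded. The shift must stay
-- general, since Pascal's rule calls the induction hypothesis at both `m` and `suc m`.
factorialSum-suc-suc : ∀ r m → factorialSum (suc r) (suc m) ≡
  (2 + m + r) * factorialSum r (suc m) + suc m * factorialSum r m
factorialSum-suc-suc zero    m = lemma m (m !)
  where
  lemma : ∀ m f → suc m * f + (2 + m) * (suc m * f) ≡ (2 + m + 0) * (suc m * f) + suc m * f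
  lemma = solve-∀
factorialSum-suc-suc (suc r) m = trans
  (cong₂ _+_ (factorialSum-suc-suc r m) (factorialSum-suc-suc r (suc m)))
  (lemma m r (factorialSum r m) (factorialSum r (1 + m)) (factorialSum r (2 + m)))
  where
  lemma : ∀ m r a b c → ((2 + m + r) * b + suc m * a) + ((3 + m + r) * c + (2 + m) * b)
                      ≡ (2 + m + suc r) * (b + c) + suc m * (a + b)
  lemma = solve-∀

-- `factorialSum r 0` is the number of repetition-free words over `r` letters: a nonempty one over
-- `suc r` letters is a first letter followed by such a word over the rest, and the empty word gives
-- the 1. The proof is algebraic instead.
factorialSum-suc : ∀ r → factorialSum (suc r) 0 ≡ suc r * factorialSum r 0 + 1
factorialSum-suc zero    = refl
factorialSum-suc (suc r) = trans
  (cong₂ _+_ (factorialSum-suc r) (factorialSum-suc-suc r 0))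
  (lemma r (factorialSum r 0) (factorialSum r 1))
  where
  lemma : ∀ r a b → (suc r * a + 1) + ((2 + r) * b + 1 * a) ≡ (2 + r) * (a + b) + 1
  lemma = solve-∀

-- On the left, 2 ^ r is half the contribution of the diagonal to the sum over
-- ordered pairs.
gpn-Q-factorialSum : ∀ r → gpn (Q (suc r)) + 2 ^ r ≡ 2 ^ r * factorialSum (suc r) 0 + 2 ^ suc r
gpn-Q-factorialSum r = begin
  sum (map (uncurry (gpn⟨_,_⟩ (Q n))) (unorderedPairs xs)) + length xs + 2 ^ r
    ≡⟨ cong₂ (λ s t → s + t + 2 ^ r) (sum-map-cong (λ (u , v) → gpn-Q u v) (unorderedPairs xs)) (length-allBits n) ⟩
  U + 2 ^ n + 2 ^ r                  ≡⟨ cong (_+ 2 ^ r) (+-comm U (2 ^ n)) ⟩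
  2 ^ n + U + 2 ^ r                  ≡⟨ +-assoc (2 ^ n) U (2 ^ r) ⟩
  2 ^ n + (U + 2 ^ r)                ≡⟨ cong (2 ^ n +_) (*-cancelʳ-≡ _ _ 2 doubled) ⟩
  2 ^ n + 2 ^ r * factorialSum n 0   ≡⟨ +-comm (2 ^ n) _ ⟩
  2 ^ r * factorialSum n 0 + 2 ^ n   ∎
  where
  open ≡-Reasoning
  n = suc r
  xs = allBits n
  f : Vec Bool n → Vec Bool n → ℕ
  f u v = hamming u v !
  U = sum (map (uncurry f) (unorderedPairs xs))
  rearrange₁ : ∀ u p → (u + p) * 2 ≡ u * 2 + 2 * p * 1
  rearrange₁ = solve-∀
  rearrange₂ : ∀ p s → 2 * p * s ≡ p * s * 2
  rearrange₂ = solve-∀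
  sum-const : ∀ c → sum (map (λ _ → c) xs) ≡ 2 ^ n * c
  sum-const c = trans (sum-map-const c xs) (cong (_* c) (length-allBits n))
  doubled : (U + 2 ^ r) * 2 ≡ 2 ^ r * factorialSum n 0 * 2
  doubled = begin
    (U + 2 ^ r) * 2                     ≡⟨ rearrange₁ U (2 ^ r) ⟩
    U * 2 + 2 ^ n * 1                   ≡⟨ cong (U * 2 +_) (sum-const 1) ⟨
    U * 2 + sum (map (λ _ → 1) xs)      ≡⟨ cong (U * 2 +_) (sum-map-cong (λ u → cong _! (hamming-refl u)) xs) ⟨
    U * 2 + sum (map (λ u → f u u) xs)  ≡⟨ sum-unorderedPairs f (λ u v → cong _! (hamming-sym u v)) xs ⟩
    sum (map (λ u → sum (map (f u) xs)) xs) ≡⟨ sum-map-cong (λ u → sum-hamming u 0) xs ⟩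
    sum (map (λ _ → factorialSum n 0) xs)   ≡⟨ sum-const (factorialSum n 0) ⟩
    2 ^ n * factorialSum n 0            ≡⟨ rearrange₂ (2 ^ r) (factorialSum n 0) ⟩
    2 ^ r * factorialSum n 0 * 2        ∎

-- The closed form and its asymptotics

fromℕ-+ : ∀ m n → fromℕ (m + n) ≡ fromℕ m ℚ.+ fromℕ n
fromℕ-+ m n = ℚ.toℚᵘ-injective (begin
  ℚ.toℚᵘ (fromℕ (m + n))                  ≈⟨ ℚ.toℚᵘ-fromℚᵘ (ℚᵘ.mkℚᵘ (ℤ.+ (m + n)) 0) ⟩
  ℚᵘ.mkℚᵘ (ℤ.+ (m + n)) 0                   ≈⟨ ℚᵘ.*≡* (cong (ℤ._* ℤ.+ 1) (cong₂ ℤ._+_ (sym (ℤ.*-identityʳ (ℤ.+ m))) (sym (ℤ.*-identityʳ (ℤ.+ n))))) ⟩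
  ℚᵘ.mkℚᵘ (ℤ.+ m) 0 ℚᵘ.+ ℚᵘ.mkℚᵘ (ℤ.+ n) 0
    ≈⟨ ℚᵘ.+-cong (ℚ.toℚᵘ-fromℚᵘ (ℚᵘ.mkℚᵘ (ℤ.+ m) 0)) (ℚ.toℚᵘ-fromℚᵘ (ℚᵘ.mkℚᵘ (ℤ.+ n) 0)) ⟨
  ℚ.toℚᵘ (fromℕ m) ℚᵘ.+ ℚ.toℚᵘ (fromℕ n)  ≈⟨ ℚ.toℚᵘ-homo-+ (fromℕ m) (fromℕ n) ⟨
  ℚ.toℚᵘ (fromℕ m ℚ.+ fromℕ n)            ∎)
  where open ℚᵘ.≃-Reasoning

factorialSum-s : ∀ r → fromℕ (factorialSum r 0) ≡ fromℕ (r !) ℚ.* s r ℚ.+ 1ℚ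
factorialSum-s zero    = refl
factorialSum-s (suc r) = begin
  fromℕ (factorialSum (suc r) 0)  ≡⟨ cong fromℕ (factorialSum-suc r) ⟩
  fromℕ (suc r * factorialSum r 0 + 1)
    ≡⟨ trans (fromℕ-+ (suc r * factorialSum r 0) 1) (cong (ℚ._+ 1ℚ) (fromℕ-* (suc r) (factorialSum r 0))) ⟩
  R ℚ.* fromℕ (factorialSum r 0) ℚ.+ 1ℚ
    ≡⟨ cong (λ x → R ℚ.* x ℚ.+ 1ℚ) (factorialSum-s r) ⟩
  R ℚ.* (F ℚ.* s r ℚ.+ 1ℚ) ℚ.+ 1ℚ
    -- Written as `1/ r !` times `r !`, the inner 1 supplies the last term of `s (suc r)`.
    ≡⟨ cong (λ x → R ℚ.* (F ℚ.* s r ℚ.+ x) ℚ.+ 1ℚ) (Euler.1/!-fact r) ⟨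
  R ℚ.* (F ℚ.* s r ℚ.+ 1/ r ! ℚ.* F) ℚ.+ 1ℚ
    ≡⟨ rearrange R F (s r) (1/ r !) ⟩
  R ℚ.* F ℚ.* s (suc r) ℚ.+ 1ℚ
    ≡⟨ cong (λ x → x ℚ.* s (suc r) ℚ.+ 1ℚ) (fromℕ-* (suc r) (r !)) ⟨
  fromℕ (suc r !) ℚ.* s (suc r) ℚ.+ 1ℚ ∎
  where
  open ≡-Reasoning
  R = fromℕ (suc r)
  F = fromℕ (r !)
  rearrange : ∀ R F x y → R ℚ.* (F ℚ.* x ℚ.+ y ℚ.* F) ℚ.+ 1ℚ ≡ R ℚ.* F ℚ.* (x ℚ.+ y) ℚ.+ 1ℚ
  rearrange = solve 4 (λ R F x y → R :* (F :* x :+ y :* F) :+ con 1ℚ := R :* F :* (x :+ y) :+ con 1ℚ) refl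

-- The identity in the natural numbers carries `2 ^ r` on the left to avoid truncated subtraction.
-- Over the rationals it is subtracted, and cancels the 1 of `factorialSum-s`.
gpn-Q-s : ∀ r → 1 ≤ r →
  fromℕ (gpn (Q r)) ≡ fromℕ (2 ^ (r ∸ 1) * r !) ℚ.* (∑[ j < r ] 1/ j !) ℚ.+ fromℕ (2 ^ r)
gpn-Q-s n@(suc r) _ = begin
  g                      ≡⟨ cancel g p ⟩
  g ℚ.+ p ℚ.- p          ≡⟨ cong (ℚ._- p) (fromℕ-+ (gpn (Q n)) (2 ^ r)) ⟨
  fromℕ (gpn (Q n) + 2 ^ r) ℚ.- p ≡⟨ cong (λ m → fromℕ m ℚ.- p) (gpn-Q-factorialSum r) ⟩
  fromℕ (2 ^ r * factorialSum n 0 + 2 ^ n) ℚ.- p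
    ≡⟨ cong (ℚ._- p) (trans (fromℕ-+ (2 ^ r * factorialSum n 0) (2 ^ n)) (cong (ℚ._+ q) (trans (fromℕ-* (2 ^ r) _) (cong (p ℚ.*_) (factorialSum-s n))))) ⟩
  p ℚ.* (F ℚ.* s n ℚ.+ 1ℚ) ℚ.+ q ℚ.- p
    ≡⟨ rearrange p F (s n) q ⟩
  p ℚ.* F ℚ.* s n ℚ.+ q  ≡⟨ cong (λ x → x ℚ.* s n ℚ.+ q) (fromℕ-* (2 ^ r) (n !)) ⟨
  fromℕ (2 ^ r * n !) ℚ.* s n ℚ.+ q ∎
  where
  open ≡-Reasoning
  g = fromℕ (gpn (Q n))
  p = fromℕ (2 ^ r)
  q = fromℕ (2 ^ n)
  F = fromℕ (n !)
  cancel : ∀ g p → g ≡ g ℚ.+ p ℚ.- p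
  cancel = solve 2 (λ g p → g := g :+ p :- p) refl
  rearrange : ∀ p F x q → p ℚ.* (F ℚ.* x ℚ.+ 1ℚ) ℚ.+ q ℚ.- p ≡ p ℚ.* F ℚ.* x ℚ.+ q
  rearrange = solve 4 (λ p F x q → p :* (F :* x :+ con 1ℚ) :+ q :- p := p :* F :* x :+ q) refl

-- Replacing the partial sum by `e`

fromℕ-nonNeg : ∀ n → 0ℚ ℚ.≤ fromℕ n
fromℕ-nonNeg n = fromℕ-mono-≤ {0} {n} z≤n

fromℕ-pos : ∀ {n} → 1 ≤ n → 0ℚ ℚ.< fromℕ n
fromℕ-pos 1≤n = ℚ.<-≤-trans (ℚ.positive⁻¹ 1ℚ) (fromℕ-mono-≤ 1≤n)

*-nonNeg : ∀ {p q} → 0ℚ ℚ.≤ p → 0ℚ ℚ.≤ q → 0ℚ ℚ.≤ p ℚ.* q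
*-nonNeg 0≤p 0≤q = *-mono-≤-0 ℚ.≤-refl 0≤p 0≤p 0≤q

1≤s : ∀ {k} → 1 ≤ k → 1ℚ ℚ.≤ s k
1≤s {suc k} _ = subst (λ m → 1ℚ ℚ.≤ s m) (+-comm k 1) (Euler.s-mono k 1)

n≤n! : ∀ n → n ≤ n !
n≤n! zero    = z≤n
n≤n! (suc n) = m≤m*n (suc n) (n !) {{n !≢0}}

leading : ℕ → ℕ
leading r = 2 ^ (r ∸ 1) * r !

-- Term `k` unfolds to `fromℕ (leading r) ℚ.* s k ℚ.+ fromℕ (2 ^ r)`, so the estimates below concern
-- rational terms.
approx : ℕ → ℝ
approx r = fromℚ (fromℕ (leading r)) *ℝ e +ℝ fromℚ (fromℕ (2 ^ r))

module _ where
  open ℚ.≤-Reasoning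

  -- Valid even at `k = 0`, where the partial sum is empty; it keeps every term away from zero.
  2^r≤approx : ∀ r k → fromℕ (2 ^ r) ℚ.≤ seq (approx r) k
  2^r≤approx r k = begin
    fromℕ (2 ^ r)          ≡⟨ ℚ.+-identityˡ (fromℕ (2 ^ r)) ⟨
    0ℚ ℚ.+ fromℕ (2 ^ r)
      ≤⟨ ℚ.+-monoˡ-≤ (fromℕ (2 ^ r)) (*-nonNeg (fromℕ-nonNeg (leading r)) (ℚ.≤-trans (Euler.s-mono k 0) (ℚ.≤-reflexive (cong s (+-identityʳ k))))) ⟩
    seq (approx r) k             ∎

  -- From `k = 1` on the partial sum contains the term 1. This bound carries the factorial that
  -- outgrows the error.
  leading≤approx : ∀ r {k} → 1 ≤ k → fromℕ (leading r) ℚ.≤ seq (approx r) k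
  leading≤approx r {k} 1≤k = begin
    P                ≡⟨ expand P ⟩
    P ℚ.* 1ℚ ℚ.+ 0ℚ
      ≤⟨ ℚ.+-mono-≤ (ℚ.*-monoˡ-≤-nonNeg P {{ℚ.nonNegative (fromℕ-nonNeg (leading r))}} (1≤s 1≤k)) (fromℕ-nonNeg (2 ^ r)) ⟩
    seq (approx r) k       ∎
    where
    P = fromℕ (leading r)
    expand : ∀ P → P ≡ P ℚ.* 1ℚ ℚ.+ 0ℚ
    expand = solve 1 (λ P → P := P :* con 1ℚ :+ con 0ℚ) refl

  -- The summands `q` cancel and a tail of the series remains, at most `2 / n!`. The factor `n !` of
  -- `leading n` cancels in turn, so the bound does not depend on `k`.
  gpn-approx : ∀ r k → suc r ≤ k →
               ℚ.∣ fromℕ (gpn (Q (suc r))) ℚ.- seq (approx (suc r)) k ∣ ℚ.≤ fromℕ (2 ^ r) ℚ.* fromℕ 2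
  gpn-approx r k n≤k = begin
    ℚ.∣ fromℕ (gpn (Q n)) ℚ.- seq (approx n) k ∣  ≡⟨ cong (λ g → ℚ.∣ g ℚ.- seq (approx n) k ∣) (gpn-Q-s n (s≤s z≤n)) ⟩
    ℚ.∣ (P ℚ.* s n ℚ.+ q) ℚ.- (P ℚ.* s k ℚ.+ q) ∣
      ≡⟨ cong ℚ.∣_∣ (factor P (s n) (s k) q) ⟩
    ℚ.∣ P ℚ.* (s n ℚ.- s k) ∣               ≡⟨ ℚ.∣p*q∣≡∣p∣*∣q∣ P (s n ℚ.- s k) ⟩
    ℚ.∣ P ∣ ℚ.* ℚ.∣ s n ℚ.- s k ∣
      ≡⟨ cong₂ ℚ._*_ (ℚ.0≤p⇒∣p∣≡p (fromℕ-nonNeg (leading n))) (∣p-q∣≡∣q-p∣ (s n) (s k)) ⟩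
    P ℚ.* ℚ.∣ s k ℚ.- s n ∣
      ≤⟨ ℚ.*-monoˡ-≤-nonNeg P {{ℚ.nonNegative (fromℕ-nonNeg (leading n))}} (Euler.tail r k n≤k) ⟩
    P ℚ.* (1/ n ! ℚ.* fromℕ 2)              ≡⟨ cong (ℚ._* (1/ n ! ℚ.* fromℕ 2)) (fromℕ-* (2 ^ r) (n !)) ⟩
    p ℚ.* F ℚ.* (1/ n ! ℚ.* fromℕ 2)
      ≡⟨ rearrange p F (1/ n !) (fromℕ 2) ⟩
    p ℚ.* (1/ n ! ℚ.* F) ℚ.* fromℕ 2        ≡⟨ cong (λ x → p ℚ.* x ℚ.* fromℕ 2) (Euler.1/!-fact n) ⟩
    p ℚ.* 1ℚ ℚ.* fromℕ 2                    ≡⟨ cong (ℚ._* fromℕ 2) (ℚ.*-identityʳ p) ⟩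
    p ℚ.* fromℕ 2                           ∎
    where
    n = suc r
    p = fromℕ (2 ^ r)
    P = fromℕ (leading n)
    q = fromℕ (2 ^ n)
    F = fromℕ (n !)
    factor : ∀ P x y q → (P ℚ.* x ℚ.+ q) ℚ.- (P ℚ.* y ℚ.+ q) ≡ P ℚ.* (x ℚ.- y)
    factor = solve 4 (λ P x y q → (P :* x :+ q) :- (P :* y :+ q) := P :* (x :- y)) refl
    rearrange : ∀ p F x t → p ℚ.* F ℚ.* (x ℚ.* t) ≡ p ℚ.* (x ℚ.* F) ℚ.* t
    rearrange = solve 4 (λ p F x t → p :* F :* (x :* t) := p :* (x :* F) :* t) refl

  -- Multiplication by the positive `b` clears the reciprocal.
  ratio-close : ∀ a b c → 0ℚ ℚ.< b → ℚ.∣ a ℚ.- b ∣ ℚ.≤ c ℚ.* b →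
                ℚ.∣ a ℚ.* ℝ-Operations.recipℚ b ℚ.- 1ℚ ∣ ℚ.≤ c
  ratio-close a b c 0<b a-b≤ = ℚ.*-cancelʳ-≤-pos b {{ℚ.positive 0<b}} (begin
    ℚ.∣ x ∣ ℚ.* b            ≡⟨ cong (ℚ.∣ x ∣ ℚ.*_) (ℚ.0≤p⇒∣p∣≡p (ℚ.<⇒≤ 0<b)) ⟨
    ℚ.∣ x ∣ ℚ.* ℚ.∣ b ∣      ≡⟨ ℚ.∣p*q∣≡∣p∣*∣q∣ x b ⟨
    ℚ.∣ x ℚ.* b ∣
      ≡⟨ cong ℚ.∣_∣ (distribute a b b′) ⟩
    ℚ.∣ a ℚ.* (b′ ℚ.* b) ℚ.- b ∣
      ≡⟨ cong (λ y → ℚ.∣ a ℚ.* y ℚ.- b ∣) (ℝ-Operations.recipℚ-inverse (ℚ.<⇒≢ 0<b ∘ sym)) ⟩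
    ℚ.∣ a ℚ.* 1ℚ ℚ.- b ∣     ≡⟨ cong (λ y → ℚ.∣ y ℚ.- b ∣) (ℚ.*-identityʳ a) ⟩
    ℚ.∣ a ℚ.- b ∣            ≤⟨ a-b≤ ⟩
    c ℚ.* b                  ∎)
    where
    b′ = ℝ-Operations.recipℚ b
    x = a ℚ.* b′ ℚ.- 1ℚ
    distribute : ∀ a b c → (a ℚ.* c ℚ.- 1ℚ) ℚ.* b ≡ a ℚ.* (c ℚ.* b) ℚ.- b
    distribute = solve 3 (λ a b c → (a :* c :- con 1ℚ) :* b := a :* (c :* b) :- b) refl

  *-swap : ∀ p q r → p ℚ.* (q ℚ.* r) ≡ q ℚ.* (p ℚ.* r)
  *-swap = solve 3 (λ p q r → p :* (q :* r) := q :* (p :* r)) refl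

  -- The number `d` will come from the Archimedean property, making `c` at least `1 / d`, while
  -- `n !` is at least `2 * d`.
  2≤c*n! : ∀ {c d n} → 0ℚ ℚ.≤ c → 1ℚ ℚ.≤ c ℚ.* fromℕ d → 2 * d ≤ n → fromℕ 2 ℚ.≤ c ℚ.* fromℕ (n !)
  2≤c*n! {c} {d} {n} 0≤c 1≤cd 2d≤n = begin
    fromℕ 2 ℚ.* 1ℚ           ≤⟨ ℚ.*-monoˡ-≤-nonNeg (fromℕ 2) 1≤cd ⟩
    fromℕ 2 ℚ.* (c ℚ.* fromℕ d)
      ≡⟨ *-swap (fromℕ 2) c (fromℕ d) ⟩
    c ℚ.* (fromℕ 2 ℚ.* fromℕ d) ≡⟨ cong (c ℚ.*_) (fromℕ-* 2 d) ⟨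
    c ℚ.* fromℕ (2 * d)
      ≤⟨ ℚ.*-monoˡ-≤-nonNeg c {{ℚ.nonNegative 0≤c}} (fromℕ-mono-≤ (≤-trans 2d≤n (n≤n! n))) ⟩
    c ℚ.* fromℕ (n !)        ∎

  -- The absolute error `2 ^ r * 2` is at most `c` times `2 ^ r * n !`, which is `leading n`. The
  -- strict bound on `n` also rules out `n = 0`.
  gpn-approx-relative : ∀ {c d} n k → 0ℚ ℚ.< c → 1ℚ ℚ.≤ c ℚ.* fromℕ d → 2 * d < n → n ≤ k →
    ℚ.∣ fromℕ (gpn (Q n)) ℚ.- seq (approx n) k ∣ ℚ.≤ c ℚ.* seq (approx n) k
  gpn-approx-relative {c} {d} n@(suc r) k 0<c 1≤cd 2d<n n≤k = begin
    ℚ.∣ fromℕ (gpn (Q n)) ℚ.- seq (approx n) k ∣   ≤⟨ gpn-approx r k n≤k ⟩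
    p ℚ.* fromℕ 2
      ≤⟨ ℚ.*-monoˡ-≤-nonNeg p {{ℚ.nonNegative (fromℕ-nonNeg (2 ^ r))}} (2≤c*n! {d = d} 0≤c 1≤cd (<⇒≤ 2d<n)) ⟩
    p ℚ.* (c ℚ.* F)           ≡⟨ *-swap p c F ⟩
    c ℚ.* (p ℚ.* F)           ≡⟨ cong (c ℚ.*_) (fromℕ-* (2 ^ r) (n !)) ⟨
    c ℚ.* fromℕ (leading n)
      ≤⟨ ℚ.*-monoˡ-≤-nonNeg c {{ℚ.nonNegative 0≤c}} (leading≤approx n (≤-trans (s≤s z≤n) n≤k)) ⟩
    c ℚ.* seq (approx n) k    ∎
    where
    p = fromℕ (2 ^ r)
    F = fromℕ (n !)
    0≤c = ℚ.<⇒≤ 0<c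

module _ (a : ℕ → ℚ) (b : ℕ → ℝ) where
  open ℚ.≤-Reasoning

  -- Reduces asymptotic equivalence to rational estimates: the lower bound makes the reciprocals
  -- defined, and `ratio-close` converts relative error into distance of the ratio from 1. The index
  -- `K` may depend on `n`, as `_<ℝ_` looks only at late terms.
  relative-error⇒∼ :
    (∀ n → ∃[ δ ] 0ℚ ℚ.< δ × ∀ k → δ ℚ.≤ seq (b n) k) →
    (∀ c → 0ℚ ℚ.< c → ∃[ N ] ∀ n → N ≤ n → ∃[ K ] ∀ k → K ≤ k →
      ℚ.∣ a n ℚ.- seq (b n) k ∣ ℚ.≤ c ℚ.* seq (b n) k) →
    (λ n → fromℚ (a n)) ∼ b
  relative-error⇒∼ lower close = apart , limit
    where
    apart : ∀ n → b n #0
    apart n with δ , 0<δ , δ≤b ← lower n = δ , 0<δ , 0 , λ k _ → begin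
      0ℚ ℚ.+ δ            ≡⟨ ℚ.+-identityˡ δ ⟩
      δ                   ≤⟨ δ≤b k ⟩
      seq (b n) k         ≡⟨ ℚ.0≤p⇒∣p∣≡p (ℚ.<⇒≤ (ℚ.<-≤-trans 0<δ (δ≤b k))) ⟨
      ℚ.∣ seq (b n) k ∣   ∎
    limit : (λ n → fromℚ (a n) *ℝ recip (b n) (apart n)) ⟶ 1ℝ
    -- Positivity of `ε` yields a rational `δ` that is eventually at most its terms. Half of `δ`
    -- bounds the error; the other half is the gap that `_<ℝ_` demands.
    limit ε (δ , 0<δ , M , δ≤ε) with close (δ ℚ.* ½) (ε½ 0<δ)
    ... | N , closeₙ = N , λ n N≤n → let (K , closeₖ) = closeₙ n N≤n ; (_ , 0<η , η≤b) = lower n in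
      c , ε½ 0<δ , M ⊔ K , λ k k≥ → begin
        ℚ.∣ a n ℚ.* ℝ-Operations.recipℚ (seq (b n) k) ℚ.- 1ℚ ∣ ℚ.+ c
          ≤⟨ ℚ.+-monoˡ-≤ c (ratio-close (a n) (seq (b n) k) c (ℚ.<-≤-trans 0<η (η≤b k))
               (closeₖ k (m⊔n≤o⇒n≤o M K k≥))) ⟩
        c ℚ.+ c      ≡⟨ ½+½ δ ⟩
        δ            ≡⟨ ℚ.+-identityˡ δ ⟨
        0ℚ ℚ.+ δ     ≤⟨ δ≤ε k (m⊔n≤o⇒m≤o M K k≥) ⟩
        seq ε k      ∎
      where c = δ ℚ.* ½

gpn-Q-∼ : (λ r → fromℚ (fromℕ (gpn (Q r)))) ∼ approx
gpn-Q-∼ = relative-error⇒∼ (λ r → fromℕ (gpn (Q r))) approx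
  (λ r → fromℕ (2 ^ r) , fromℕ-pos (m^n>0 2 r) , 2^r≤approx r) close
  where
  close : ∀ c → 0ℚ ℚ.< c → ∃[ N ] ∀ n → N ≤ n → ∃[ K ] ∀ k → K ≤ k →
          ℚ.∣ fromℕ (gpn (Q n)) ℚ.- seq (approx n) k ∣ ℚ.≤ c ℚ.* seq (approx n) k
  close c 0<c = let d , 1≤cd = archimedean c 0<c in
    -- This threshold turns `N ≤ n` into `2 * d < n`. Terms are taken from `k = n` on because the
    -- tail bound compares `s n` with later partial sums.
    suc (2 * d) , λ n 2d<n → n , λ k n≤k → gpn-approx-relative {c} {d} n k 0<c 1≤cd 2d<n n≤k

proposition4 : (∀ (r : ℕ) → 1 ≤ r →
    fromℕ (gpn (Q r))
    ≡ fromℕ (2 ^ (r ∸ 1) * r !) ℚ.* (∑[ j < r ] 1/ j !) ℚ.+ fromℕ (2 ^ r))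
    × ((λ r → fromℚ (fromℕ (gpn (Q r))))
    ∼ (λ r → fromℚ (fromℕ (2 ^ (r ∸ 1) * r !)) *ℝ e +ℝ fromℚ (fromℕ (2 ^ r))))
proposition4 = gpn-Q-s , gpn-Q-∼
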